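{- For every natural number $n\geq 8$, the cost of edge-distinguishing $\rho'(K_n)$ of the complete graph $K_n$ equals the number of red edges of an almost spanning asymmetric forest produced by Procedure P (described in the context). In particular, for $n\geq 8$, $$\rho'(K_{n}) = n-\sum_{i=1}^{N} a_{i} - w,$$ where $a_i$ is the number of (isomorphism classes of) asymmetric trees with $i$ vertices, and the integers $N$, $w$ are defined by $$\sum_{i=1}^{N} i a_i \leq n < \sum_{i=1}^{N+1} i a_{i}, \qquad n=\sum_{i=1}^{N} i a_{i} + w(N+1)+r,\quad 0\leq w<a_{N+1},\quad 0\leq r<N+1 .$$
   Context: A graph is asymmetric if its only automorphism is the identity; the one-vertex tree is asymmetric (so $a_1=1$), and the smallest asymmetric tree with more than one vertex has $7$ vertices. An edge coloring of a graph $G$ is distinguishing if no automorphism of $G$ other than the identity preserves it. The distinguishing index $D'(G)$ is the least number of colors in a distinguishing edge coloring. When $D'(G)=2$ (this holds for $K_n$ with $n\ge 6$), the cost of edge-distinguishing (edge-cost) $\rho'(G)$ is the least number of edges in the smaller of the two color classes, over all distinguishing edge colorings of $G$ with two colors. Let $\Omega=\{T_1,T_2,\ldots\}$ be a list of the asymmetric trees with more than one vertex, each isomorphism class listed once, with $|T_j|\ge |T_i|$ (number of vertices) whenever $j>i$. Procedure P, for $K_n$ with $n\ge 8$ (initially all vertices are available): Step 1. Choose a vertex of $K_n$ and remove it from the set of available vertices. Step 2. Take the first tree $T_i$ of $\Omega$ not already used. Choose $|T_i|$ available vertices and color red some edges of the subgraph they induce so that the red edges form a graph isomorphic to $T_i$.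 Remove the chosen vertices from the set of available vertices. Step 3. If the number of available vertices is at least the number of vertices of the first tree of $\Omega$ not already used, go to Step 2. Otherwise, if the number of available vertices is zero, go to Step 4; if it is not zero, delete the last chosen red asymmetric tree, put its vertices back into the set of available vertices, choose from $\Omega$ a tree $T^\ast$ having exactly as many vertices as are available, color red some edges of the subgraph induced by the available vertices so that the red edges form a graph isomorphic to $T^\ast$, and go to Step 4. Step 4. Color all remaining edges blue. The forest produced by the procedure is the graph formed by the red edges; it covers all vertices except the one removed in Step 1 ("almost spanning"). -}

module Defs where

open import Data.Bool.Base using (Bool; true; false; T; not; if_then_else_)
open import Data.Bool.Properties using (T?)
open import Data.Empty using (⊥-elim)
open import Data.Fin.Base using (Fin; zero; suc; inject₁; fromℕ)
open import Data.Fin.Patterns using (0F; 1F)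
open import Data.Fin.Permutation as Perm
  using (Permutation; _⟨$⟩ʳ_; inverseʳ; _∘ₚ_; flip)
open import Data.Fin.Properties as Fin using (_≟_; _<?_)
open import Data.Fin.Subset using (Subset; _⊆_; _∪_; _─_; _-_; ∣_∣; ⊤)
open import Data.List.Base using (List; []; _∷_; length; filter; map; cartesianProduct; allFin)
open import Data.List.Membership.Propositional using (_∈_; _∉_)
open import Data.List.Relation.Unary.Any as Any using (Any)
open import Data.Nat.Base using (ℕ; zero; suc; _+_; _*_; _≤_; _<_; _⊓_)
open import Data.Product.Base using (∃-syntax; _×_; _,_)
open import Data.Vec.Base using (tabulate)
open import Function.Bundles using (Bijection; mk⇔)
open import Function.Definitions using (Injective)
open import Level using (0ℓ)
open import Relation.Binary.Bundles using (Setoid)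
open import Relation.Binary.Construct.Closure.ReflexiveTransitive using (Star)
open import Relation.Binary.PropositionalEquality
  using (_≡_; _≢_; refl; sym; trans; cong; cong₂; subst; setoid)
open import Relation.Nullary using (¬_; Dec; yes; no; does)
open import Relation.Nullary.Decidable using (_×-dec_; does-⇔; dec-true)

------------------------------------------------------------------------
-- Finite simple graphs on the vertex set Fin n

record Graph (n : ℕ) : Set where
  field
    adj        : Fin n → Fin n → Bool
    adj-sym    : ∀ u v → adj u v ≡ adj v u
    adj-irrefl : ∀ v → adj v v ≡ false

open Graph public

Adj : ∀ {n} → Graph n → Fin n → Fin n → Set
Adj G u v = T (adj G u v)

-- Each edge is counted once, as the pair (u , v) with u < v.
#edges : ∀ {n} → Graph n → ℕ
#edges {n} G =
  length (filter (λ (u , v) → (u <? v) ×-dec T? (adj G u v))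
                 (cartesianProduct (allFin n) (allFin n)))

K : ∀ n → Graph n
K n = record
  { adj        = λ u v → not (does (u ≟ v))
  ; adj-sym    = λ u v → cong not (does-⇔ (mk⇔ sym sym) (u ≟ v) (v ≟ u))
  ; adj-irrefl = λ v → cong not (dec-true (v ≟ v) refl)
  }

infix 4 _≅_

record _≅_ {m n} (G : Graph m) (H : Graph n) : Set where
  field
    bij       : Permutation m n
    preserves : ∀ u v → adj H (bij ⟨$⟩ʳ u) (bij ⟨$⟩ʳ v) ≡ adj G u v

open _≅_ public

≅-refl : ∀ {n} {G : Graph n} → G ≅ G
≅-refl = record { bij = Perm.id ; preserves = λ _ _ → refl }

≅-sym : ∀ {m n} {G : Graph m} {H : Graph n} → G ≅ H → H ≅ G
≅-sym {H = H} φ = record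
  { bij       = flip (bij φ)
  ; preserves = λ u v → trans (sym (preserves φ _ _))
                              (cong₂ (adj H) (inverseʳ (bij φ)) (inverseʳ (bij φ)))
  }

≅-trans : ∀ {l m n} {G : Graph l} {H : Graph m} {I : Graph n} → G ≅ H → H ≅ I → G ≅ I
≅-trans φ ψ = record
  { bij       = bij φ ∘ₚ bij ψ
  ; preserves = λ u v → trans (preserves ψ _ _) (preserves φ u v)
  }

Automorphism : ∀ {n} → Graph n → Set
Automorphism G = G ≅ G

IsIdentity : ∀ {n} {G : Graph n} → Automorphism G → Set
IsIdentity σ = ∀ v → bij σ ⟨$⟩ʳ v ≡ v

Asymmetric : ∀ {n} → Graph n → Set
Asymmetric G = (σ : Automorphism G) → IsIdentity σ

-- The null graph is not connected, so a tree has at least one vertex.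
Connected : ∀ {n} → Graph n → Set
Connected {n} G = Fin n × (∀ u v → Star (Adj G) u v)

-- A cycle of length 3 + k.
record Cycle {n} (G : Graph n) (k : ℕ) : Set where
  field
    vertex    : Fin (3 + k) → Fin n
    injective : Injective _≡_ _≡_ vertex
    step      : ∀ i → Adj G (vertex (inject₁ i)) (vertex (suc i))
    close     : Adj G (vertex (fromℕ (2 + k))) (vertex zero)

IsForest : ∀ {n} → Graph n → Set
IsForest G = ∀ k → ¬ Cycle G k

IsTree : ∀ {n} → Graph n → Set
IsTree G = Connected G × IsForest G

------------------------------------------------------------------------
-- Edge colorings

-- Irrelevance makes the color depend on the pair of adjacent vertices only,
-- not on the proof of adjacency.
record EdgeColoring {n} (G : Graph n) (k : ℕ) : Set where
  field
    color     : ∀ u v → .(Adj G u v) → Fin k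
    color-sym : ∀ u v .(e : Adj G u v) .(e′ : Adj G v u) → color u v e ≡ color v u e′

open EdgeColoring public

Preserves : ∀ {n k} {G : Graph n} → Automorphism G → EdgeColoring G k → Set
Preserves {G = G} σ c =
  ∀ u v (e : Adj G u v) (e′ : Adj G (bij σ ⟨$⟩ʳ u) (bij σ ⟨$⟩ʳ v)) →
  color c (bij σ ⟨$⟩ʳ u) (bij σ ⟨$⟩ʳ v) e′ ≡ color c u v e

Distinguishing : ∀ {n k} {G : Graph n} → EdgeColoring G k → Set
Distinguishing {G = G} c = (σ : Automorphism G) → Preserves σ c → IsIdentity σ

IsDistinguishingIndex : ∀ {n} → Graph n → ℕ → Set
IsDistinguishingIndex G k =
  (∃[ c ] Distinguishing {k = k} {G = G} c) ×
  (∀ j (c : EdgeColoring G j) → Distinguishing c → k ≤ j)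

-- The spanning subgraph whose edges are the edges of color i.
colorClass : ∀ {n k} {G : Graph n} → EdgeColoring G k → Fin k → Graph n
colorClass {n} {G = G} c i = record
  { adj        = λ u v → has u v (T? (adj G u v))
  ; adj-sym    = λ u v → has-sym u v (T? (adj G u v)) (T? (adj G v u))
  ; adj-irrefl = λ v → has-irrefl v (T? (adj G v v))
  }
  where
  has : ∀ u v → Dec (Adj G u v) → Bool
  has u v (yes e) = does (color c u v e ≟ i)
  has u v (no _)  = false

  Adj-sym : ∀ u v → Adj G u v → Adj G v u
  Adj-sym u v e rewrite adj-sym G u v = e

  has-sym : ∀ u v (d : Dec (Adj G u v)) (d′ : Dec (Adj G v u)) → has u v d ≡ has v u d′
  has-sym u v (yes e) (yes e′) = cong (λ j → does (j ≟ i)) (color-sym c u v e e′)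
  has-sym u v (yes e) (no ¬e′) = ⊥-elim (¬e′ (Adj-sym u v e))
  has-sym u v (no ¬e) (yes e′) = ⊥-elim (¬e (Adj-sym v u e′))
  has-sym u v (no _)  (no _)   = refl

  has-irrefl : ∀ v (d : Dec (Adj G v v)) → has v v d ≡ false
  has-irrefl v (yes e) = ⊥-elim (subst T (adj-irrefl G v) e)
  has-irrefl v (no _)  = refl

smallerClass : ∀ {n} {G : Graph n} → EdgeColoring G 2 → ℕ
smallerClass c = #edges (colorClass c 0F) ⊓ #edges (colorClass c 1F)

-- ρ′(G) is defined, and equal to k.
record IsEdgeCost {n} (G : Graph n) (k : ℕ) : Set where
  field
    index-two : IsDistinguishingIndex G 2
    attained  : ∃[ c ] Distinguishing {G = G} c × smallerClass c ≡ k
    minimal   : (c : EdgeColoring G 2) → Distinguishing c → k ≤ smallerClass c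

------------------------------------------------------------------------
-- Asymmetric trees up to isomorphism

record AsymTree (m : ℕ) : Set where
  field
    graph      : Graph m
    isTree     : IsTree graph
    asymmetric : Asymmetric graph

open AsymTree public

AsymTrees : ℕ → Setoid 0ℓ 0ℓ
AsymTrees m = record
  { Carrier       = AsymTree m
  ; _≈_           = λ S T → graph S ≅ graph T
  ; isEquivalence = record { refl = ≅-refl ; sym = ≅-sym ; trans = ≅-trans }
  }

-- a i is the number of isomorphism classes of asymmetric trees with i vertices.
CountsAsymTrees : (ℕ → ℕ) → Set
CountsAsymTrees a = ∀ i → Bijection (AsymTrees i) (setoid (Fin (a i)))

-- The list Ω, indexed from 0.
record TreeList : Set where
  field
    order      : ℕ → ℕ
    tree       : ∀ i → AsymTree (order i)
    nontrivial : ∀ i → 1 < order i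
    complete   : ∀ {m} (S : AsymTree m) → 1 < m → ∃[ i ] graph S ≅ graph (tree i)
    distinct   : ∀ i j → graph (tree i) ≅ graph (tree j) → i ≡ j
    monotone   : ∀ i j → i < j → order i ≤ order j

------------------------------------------------------------------------
-- Procedure P on K n

module Procedure (Ω : TreeList) (n : ℕ) where

  open TreeList Ω

  -- A red copy of a tree of Ω; `at` is the isomorphism onto the copy.
  record Copy : Set where
    field
      index     : ℕ
      at        : Fin (order index) → Fin n
      injective : Injective _≡_ _≡_ at

  open Copy public

  vertices : Copy → Subset n
  vertices p = tabulate λ v → does (Fin.any? λ x → at p x ≟ v)

  -- The red copies are listed with the last chosen one first.
  record State : Set where
    constructor ⟨_,_,_⟩
    field
      removed   : Fin n
      available : Subset n
      copies    : List Copy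

  open State public

  FirstUnused : State → ℕ → Set
  FirstUnused s i = i ∉ used × (∀ j → j < i → j ∈ used)
    where used = map index (copies s)

  Continue : State → Set
  Continue s = ∃[ i ] FirstUnused s i × order i ≤ ∣ available s ∣

  -- AtStepᵢ s: some execution reaches Step i in state s.
  mutual
    data AtStep₂ : State → Set where
      step₁ : ∀ v → AtStep₂ ⟨ v , ⊤ - v , [] ⟩
      loop  : ∀ {s} → AtStep₃ s → Continue s → AtStep₂ s

    data AtStep₃ : State → Set where
      step₂ : ∀ {s} → AtStep₂ s →
              (p : Copy) → FirstUnused s (index p) → vertices p ⊆ available s →
              AtStep₃ ⟨ removed s , available s ─ vertices p , p ∷ copies s ⟩

  data AtStep₄ : State → Set where
    finish  : ∀ {s} → AtStep₃ s → ¬ Continue s → ∣ available s ∣ ≡ 0 → AtStep₄ s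
    -- p is deleted, and replaced by the copy q of T*.
    replace : ∀ {v A p ps} → let A′ = A ∪ vertices p in
              AtStep₃ ⟨ v , A , p ∷ ps ⟩ → ¬ Continue ⟨ v , A , p ∷ ps ⟩ → ∣ A ∣ ≢ 0 →
              (q : Copy) → order (index q) ≡ ∣ A′ ∣ → vertices q ⊆ A′ →
              AtStep₄ ⟨ v , A′ ─ vertices q , q ∷ ps ⟩

  InCopy : Fin n → Fin n → Copy → Set
  InCopy u v p = ∃[ x ] ∃[ y ] at p x ≡ u × at p y ≡ v × Adj (graph (tree (index p))) x y

  red? : ∀ ps u v → Dec (Any (InCopy u v) ps)
  red? ps u v = Any.any? (λ p → Fin.any? λ x → Fin.any? λ y →
    (at p x ≟ u) ×-dec (at p y ≟ v) ×-dec T? _) ps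

  InCopy-sym : ∀ {u v} p → InCopy u v p → InCopy v u p
  InCopy-sym p (x , y , xu , yv , e)
    rewrite adj-sym (graph (tree (index p))) x y = y , x , yv , xu , e

  red blue : Fin 2
  red  = 0F
  blue = 1F

  -- Step 4.
  coloring : State → EdgeColoring (K n) 2
  coloring s = record
    { color     = λ u v _ → if does (red? (copies s) u v) then red else blue
    ; color-sym = λ u v _ _ → cong (if_then red else blue)
        (does-⇔ (mk⇔ (Any.map λ {p} → InCopy-sym p) (Any.map λ {p} → InCopy-sym p))
                (red? (copies s) u v) (red? (copies s) v u))
    }

  record Run : Set where
    field
      final   : State
      reached : AtStep₄ final

  open Run public

  -- The red edges on the vertex set of K n, so the forest produced together with
  -- the removed vertex.  That vertex is the only isolated one, hence fixed by
  -- every automorphism, so this graph is asymmetric iff the forest itself is.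
  forest : Run → Graph n
  forest R = colorClass (coloring (final R)) red

  -- The vertices covered by the red edges are all those other than the one
  -- removed in Step 1.
  AlmostSpanning : Run → Set
  AlmostSpanning R =
    (∀ v → v ≢ removed (final R) → ∃[ u ] Adj (forest R) v u) ×
    (∀ u → ¬ Adj (forest R) (removed (final R)) u)

------------------------------------------------------------------------
-- The closed formula

-- f 1 + … + f N
∑₁ : ℕ → (ℕ → ℕ) → ℕ
∑₁ zero    f = 0
∑₁ (suc N) f = ∑₁ N f + f (suc N)

record Expansion (a : ℕ → ℕ) (n N w r : ℕ) : Set where
  field
    lower : ∑₁ N (λ i → i * a i) ≤ n
    upper : n < ∑₁ (suc N) (λ i → i * a i)
    split : n ≡ ∑₁ N (λ i → i * a i) + w * suc N + r
    w-bound : w < a (suc N)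
    r-bound : r < suc N

{-# OPTIONS --safe #-}

-- A 2-coloring of K n is distinguishing iff its red (equivalently, blue) graph is asymmetric, so ρ′ is
-- the least number of edges of an asymmetric graph on n vertices.  In such a graph every component
-- that is not a tree has at least as many edges as vertices, so the number of edges is at least n minus
-- the number of tree components; these are pairwise non-isomorphic asymmetric trees with at most n
-- vertices in total.  Their number is largest, say k, when the smallest trees are used, and Procedure P
-- reaches k: replacing the last tree by T* does not change the number of components.  Running it needs
-- an asymmetric tree of every order ≥ 7 (a spider) and none of order 2, …, 6 (checked by enumeration).

module Submission where

open import Defs
open import Data.Bool.Base using (Bool; true; false; T; if_then_else_)
open import Data.Bool.Properties as Bool using (T?)
open import Data.Empty using (⊥; ⊥-elim)
open import Data.Fin.Base as Fin
  using (Fin; zero; suc; toℕ; fromℕ; fromℕ<; inject₁; punchIn; punchOut)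
open import Data.Fin.Patterns using (0F; 1F; 2F; 3F; 4F; 5F; 6F)
open import Data.Fin.Permutation as Perm
  using (Permutation; _⟨$⟩ʳ_; _⟨$⟩ˡ_; inverseˡ; inverseʳ; ↔⇒≡)
open import Data.Fin.Properties as Fin
  using (_≟_; _<?_; any?; all?; toℕ-injective; toℕ<n; toℕ-fromℕ<; toℕ-fromℕ; toℕ-inject₁)
open import Data.Fin.Relation.Unary.Top using (view; ‵fromℕ; ‵inject₁)
open import Data.Fin.Induction using (<-weakInduction)
open import Data.Fin.Subset as Subset using (Subset; inside; outside; ⁅_⁆; _∪_; _─_; ∣_∣; _⊆_)
import Data.Fin.Subset.Properties as Subset
open import Data.Integer.Base using (+_; _-_)
import Data.Integer.Properties as ℤ
open import Data.List.Base
  using (List; []; _∷_; downFrom; _++_; length; map; filter; concat; concatMap; cartesianProduct;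
         allFin; lookup)
open import Data.List.Properties using (length-map; length-++; length-tabulate; length-++-sucʳ)
open import Data.List.Membership.Propositional using (_∈_; _∉_; find)
open import Data.List.Membership.Propositional.Properties
  using (∈-∃++; ∈-++⁺ˡ; ∈-++⁺ʳ; ∈-++⁻; ∈-map⁺; ∈-map⁻; ∈-filter⁺; ∈-filter⁻; ∈-allFin;
         ∈-cartesianProduct⁺; ∈-lookup; ∈-downFrom⁺; ∈-downFrom⁻)
open import Data.List.Relation.Unary.All as All using (All; []; _∷_)
import Data.List.Relation.Unary.All.Properties as AllP
open import Data.List.Relation.Unary.AllPairs as AllPairs using (AllPairs; []; _∷_)
import Data.List.Relation.Unary.AllPairs.Properties as AllPairsP
open import Data.List.Relation.Unary.Any as Any using (Any; here; there)
open import Data.List.Relation.Unary.Any.Properties using (lookup-index)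
open import Data.List.Relation.Binary.Disjoint.Propositional using (Disjoint)
open import Data.List.Relation.Unary.Unique.Propositional using (Unique)
import Data.List.Relation.Unary.Unique.Propositional.Properties as Unique
open import Data.Nat.Base using (ℕ; zero; suc; _+_; _*_; _∸_; _≤_; _<_; z≤n; s≤s)
open import Data.Nat.DivMod using (_/_; _%_; m≡m%n+[m/n]*n; m/n*n≤m; m%n<n)
open import Data.Nat.ListAction using (sum)
open import Data.Nat.Properties as ℕ
  using (≤-refl; ≤-trans; ≤-reflexive; ≤-<-trans; ≮⇒≥; ≰⇒>; <⇒≱; <⇒≤; +-comm; +-assoc; +-suc;
         +-identityʳ; +-mono-≤; +-monoˡ-≤; +-monoʳ-≤)
open import Data.Product.Base using (∃-syntax; _×_; _,_; proj₁; proj₂; uncurry)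
open import Data.Sum.Base as Sum using (_⊎_; inj₁; inj₂; [_,_]′)
open import Data.Unit.Base using (⊤; tt)
open import Data.Vec.Base using ([]; _∷_; here; there)
import Data.Vec.Properties as Vec
open import Function.Base using (_∘_; id; case_of_)
open import Function.Bundles using (Bijection)
open import Function.Definitions using (Injective)
open import Relation.Binary.Construct.Closure.ReflexiveTransitive as Star using (Star; ε; _◅_; _◅◅_)
open import Relation.Binary.Definitions using (tri<; tri≈; tri>)
open import Relation.Binary.PropositionalEquality
  using (_≡_; _≢_; refl; sym; trans; cong; cong₂; subst; subst₂; module ≡-Reasoning)
open import Relation.Nullary using (¬_; Dec; yes; no; does; contradiction)
open import Relation.Nullary.Decidable
  using (_×-dec_; _⊎-dec_; _→-dec_; toWitness; ¬?; dec-true; dec-false; map′; decidable-stable)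
open import Relation.Unary using (Decidable)

-- The removed vertex is isolated in the red graph, so it is a component isomorphic to the
-- one-vertex tree, which Ω omits. With that tree put in front (`order⁺`, `tree⁺`), the runs of the
-- procedure, the components of an arbitrary asymmetric graph and the numbers a_i are all measured
-- against one nondecreasing sequence of orders. The number k is pinned down by `Maximal n k`: the
-- first k trees fit into n vertices, the first k + 1 do not. A finished run satisfies this because
-- the next tree did not fit, and ∑ a_i + w satisfies it because r < N + 1; hence all runs and all
-- expansions yield the same k. The edges of the red forest are counted only from above; the lower
-- bound, applied to the forest itself, forces equality. The order 7 enters twice: the first tree of
-- Ω fits into the n - 1 vertices left by Step 1, and the vertices available after a deletion number
-- at least 7, so T* exists. T* differs from the trees still in place because it is strictly larger
-- than the deleted tree, the largest so far.

private
  variable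
    A B : Set
    l m n : ℕ

-- Least witnesses, maxima, and counting with lists

least : {P : ℕ → Set} → Decidable P → ∀ k → P k → ∃[ l ] P l × (∀ j → j < l → ¬ P j)
least P? k pk with P? 0
... | yes p0 = 0 , p0 , λ _ ()
least P? zero    pk | no ¬p0 = contradiction pk ¬p0
least P? (suc k) pk | no ¬p0 with least (P? ∘ suc) k pk
... | l , pl , min = suc l , pl , λ { zero _ p0 → ¬p0 p0 ; (suc j) (s≤s j<l) → min j j<l }

argmax : (f : Fin (suc n) → ℕ) → ∃[ i ] (∀ j → f j ≤ f i)
argmax {zero}  f = zero , λ { zero → ≤-refl }
argmax {suc n} f with argmax (f ∘ suc)
... | i , max with f zero ℕ.≤? f (suc i)
... | yes f0≤ = suc i , λ { zero → f0≤ ; (suc j) → max j }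
... | no  f0≰ = zero , λ { zero → ≤-refl ; (suc j) → ≤-trans (max j) (ℕ.≰⇒≥ f0≰) }

∈-removed : ∀ (ys : List A) {x z zs} → z ∈ ys ++ x ∷ zs → z ≢ x → z ∈ ys ++ zs
∈-removed ys z∈ z≢x with ∈-++⁻ ys z∈
... | inj₁ z∈ys         = ∈-++⁺ˡ z∈ys
... | inj₂ (here z≡x)   = contradiction z≡x z≢x
... | inj₂ (there z∈zs) = ∈-++⁺ʳ ys z∈zs

-- The tool behind the counts of edges and vertices. As `xs` has no repetitions, its head can be
-- deleted from `ys` without losing the other members.
length-mono-⊆ : {xs ys : List A} → Unique xs → (∀ {x} → x ∈ xs → x ∈ ys) → length xs ≤ length ys
length-mono-⊆ [] _ = z≤n
length-mono-⊆ {xs = x ∷ xs} (x≢ ∷ uniq) sub with ∈-∃++ (sub (here refl))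
... | ys , zs , refl = ≤-trans
  (s≤s (length-mono-⊆ uniq λ z∈ → ∈-removed ys (sub (there z∈)) λ { refl → All.lookup x≢ z∈ refl }))
  (≤-reflexive (sym (length-++-sucʳ ys x zs)))

length-unique-Fin : {xs : List (Fin n)} → Unique xs → length xs ≤ n
length-unique-Fin {n} uniq =
  ≤-trans (length-mono-⊆ uniq λ {x} _ → ∈-allFin x) (≤-reflexive (length-tabulate {n = n} id))

map-unique : (f : A → B) {xs : List A} → (∀ {x y} → x ∈ xs → y ∈ xs → f x ≡ f y → x ≡ y) →
             Unique xs → Unique (map f xs)
map-unique f inj [] = []
map-unique f {x ∷ xs} inj (x≢ ∷ uniq) =
  All.tabulate (λ y∈ fx≡y → case ∈-map⁻ f y∈ of λ { (z , z∈ , refl) →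
    All.lookup x≢ z∈ (inj (here refl) (there z∈) fx≡y) })
  ∷ map-unique f (λ x∈ y∈ → inj (there x∈) (there y∈)) uniq

lookup-injective : {xs : List A} → Unique xs → ∀ i j → lookup xs i ≡ lookup xs j → i ≡ j
lookup-injective (_ ∷ _)    zero    zero    _  = refl
lookup-injective (x≢ ∷ _)   zero    (suc j) eq = contradiction eq (All.lookup x≢ (∈-lookup j))
lookup-injective (x≢ ∷ _)   (suc i) zero    eq = contradiction (sym eq) (All.lookup x≢ (∈-lookup i))
lookup-injective (_ ∷ uniq) (suc i) (suc j) eq = cong suc (lookup-injective uniq i j eq)

length-filter-¬ : {P : A → Set} (P? : Decidable P) (xs : List A) →
                  length xs ≡ length (filter (¬? ∘ P?) xs) + length (filter P? xs)
length-filter-¬ P? [] = refl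
length-filter-¬ P? (x ∷ xs) with P? x
... | yes _ = trans (cong suc (length-filter-¬ P? xs)) (sym (+-suc _ _))
... | no _  = cong suc (length-filter-¬ P? xs)

sum< : (ℕ → ℕ) → ℕ → ℕ
sum< e zero    = 0
sum< e (suc k) = sum< e k + e k

sum<-mono-≤ : ∀ e {k l} → k ≤ l → sum< e k ≤ sum< e l
sum<-mono-≤ e {k} {zero}  z≤n = z≤n
sum<-mono-≤ e {k} {suc l} k≤1+l with k ℕ.≤? l
... | yes k≤l = ≤-trans (sum<-mono-≤ e k≤l) (ℕ.m≤m+n _ _)
... | no  k≰l = ≤-reflexive (cong (sum< e) (ℕ.≤-antisym k≤1+l (≰⇒> k≰l)))

sum-removed : (f : A → ℕ) (ys : List A) {x : A} {zs : List A} →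
              sum (map f (ys ++ x ∷ zs)) ≡ sum (map f (ys ++ zs)) + f x
sum-removed f []       {x} {zs} = +-comm (f x) (sum (map f zs))
sum-removed f (y ∷ ys) {x} {zs} = trans (cong (_+_ (f y)) (sum-removed f ys)) (sym (+-assoc (f y) _ (f x)))

removed-unique : (ys : List A) {x : A} {zs : List A} → Unique (ys ++ x ∷ zs) → Unique (ys ++ zs)
removed-unique []       (_ ∷ uniq)  = uniq
removed-unique (y ∷ ys) (y≢ ∷ uniq) =
  All.tabulate (λ z∈ → All.lookup y≢ (weaken z∈)) ∷ removed-unique ys uniq
  where
  weaken : ∀ {z} → z ∈ ys ++ _ → z ∈ ys ++ _ ∷ _
  weaken z∈ with ∈-++⁻ ys z∈
  ... | inj₁ z∈ys = ∈-++⁺ˡ z∈ys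
  ... | inj₂ z∈zs = ∈-++⁺ʳ ys (there z∈zs)

upTo-unique-length : ∀ {k xs} → Unique xs → All (_< k) xs → length xs ≤ k
upTo-unique-length {k} {xs} uniq bound =
  Fin.injective⇒≤ {f = λ i → fromℕ< (All.lookup bound (∈-lookup i))} λ {i} {j} eq →
    lookup-injective uniq i j (trans (sym (toℕ-fromℕ< _)) (trans (cong toℕ eq) (toℕ-fromℕ< _)))

-- Distinct arguments are summed greedily: some element of xs is at least length xs - 1.
sum-distinct : ∀ {e} → (∀ {i j} → i ≤ j → e i ≤ e j) →
               ∀ k {xs} → length xs ≡ k → Unique xs → sum< e k ≤ sum (map e xs)
sum-distinct mono zero    len uniq = z≤n
sum-distinct {e} mono (suc k) {xs} len uniq with Any.any? (k ℕ.≤?_) xs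
... | no ¬big = contradiction
      (upTo-unique-length {k} uniq (All.tabulate λ {x} x∈ → ≰⇒> λ k≤x → ¬big (Any.map (λ { refl → k≤x }) x∈)))
      (<⇒≱ (≤-reflexive (sym len)))
... | yes big with find big
... | x , x∈ , k≤x with ∈-∃++ x∈
... | ys , zs , refl = ≤-trans
  (+-mono-≤ (sum-distinct mono k (ℕ.suc-injective (trans (sym (length-++-sucʳ ys x zs)) len)) (removed-unique ys uniq))
            (mono k≤x))
  (≤-reflexive (sym (sum-removed e ys)))

-- Bounds on the number of edges

Adj-sym : (G : Graph n) → ∀ {u v} → Adj G u v → Adj G v u
Adj-sym G {u} {v} e = subst T (adj-sym G u v) e

Adj-irrefl : (G : Graph n) → ∀ {u v} → Adj G u v → u ≢ v
Adj-irrefl G {u} e refl = subst T (adj-irrefl G u) e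

does⁻ : {P : Set} (d : Dec P) → T (does d) → P
does⁻ (yes p) _ = p

does⁺ : {P : Set} (d : Dec P) → P → T (does d)
does⁺ (yes _) _ = tt
does⁺ (no ¬p) p = contradiction p ¬p

T-ext : {b c : Bool} → (T b → T c) → (T c → T b) → b ≡ c
T-ext {false} {false} f g = refl
T-ext {false} {true}  f g = ⊥-elim (g tt)
T-ext {true}  {false} f g = ⊥-elim (f tt)
T-ext {true}  {true}  f g = refl

-- The list measured by `#edges`: `length (edges G)` and `#edges G` agree definitionally.
edges : Graph n → List (Fin n × Fin n)
edges {n} G = filter (λ (u , v) → (u <? v) ×-dec T? (adj G u v)) (cartesianProduct (allFin n) (allFin n))

∈-edges⁺ : (G : Graph n) → ∀ {u v} → u Fin.< v → Adj G u v → (u , v) ∈ edges G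
∈-edges⁺ G {u} {v} u<v e =
  ∈-filter⁺ (λ (u , v) → (u <? v) ×-dec T? (adj G u v)) (∈-cartesianProduct⁺ (∈-allFin u) (∈-allFin v)) (u<v , e)

∈-edges⁻ : (G : Graph n) → ∀ {u v} → (u , v) ∈ edges G → u Fin.< v × Adj G u v
∈-edges⁻ {n} G uv∈ =
  proj₂ (∈-filter⁻ (λ (u , v) → (u <? v) ×-dec T? (adj G u v)) {xs = cartesianProduct (allFin n) (allFin n)} uv∈)

edges-unique : (G : Graph n) → Unique (edges G)
edges-unique {n} G = Unique.filter⁺ _ (Unique.cartesianProduct⁺ (Unique.allFin⁺ n) (Unique.allFin⁺ n))

orient : Fin n × Fin n → Fin n × Fin n
orient (u , v) with u <? v
... | yes _ = u , v
... | no _  = v , u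

SameEdge : Fin n × Fin n → Fin n × Fin n → Set
SameEdge (u , v) (u′ , v′) = (u ≡ u′ × v ≡ v′) ⊎ (u ≡ v′ × v ≡ u′)

orient-injective : (p q : Fin n × Fin n) → orient p ≡ orient q → SameEdge p q
orient-injective (u , v) (u′ , v′) eq with u <? v | u′ <? v′
orient-injective _ _ refl | yes _ | yes _ = inj₁ (refl , refl)
orient-injective _ _ refl | yes _ | no _  = inj₂ (refl , refl)
orient-injective _ _ refl | no _  | yes _ = inj₂ (refl , refl)
orient-injective _ _ refl | no _  | no _  = inj₁ (refl , refl)

SameEdge-unique : {p q r : Fin n × Fin n} → SameEdge p r → SameEdge q r →
                  uncurry Fin._<_ p → uncurry Fin._<_ q → p ≡ q
SameEdge-unique (inj₁ (refl , refl)) (inj₁ (refl , refl)) _  _  = refl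
SameEdge-unique (inj₁ (refl , refl)) (inj₂ (refl , refl)) p< q< = contradiction p< (Fin.<-asym q<)
SameEdge-unique (inj₂ (refl , refl)) (inj₁ (refl , refl)) p< q< = contradiction p< (Fin.<-asym q<)
SameEdge-unique (inj₂ (refl , refl)) (inj₂ (refl , refl)) _  _  = refl

orient-∈ : (G : Graph n) (p : Fin n × Fin n) → uncurry (Adj G) p → orient p ∈ edges G
orient-∈ G (u , v) e with Fin.<-cmp u v | u <? v
... | tri< u<v _ _ | yes _   = ∈-edges⁺ G u<v e
... | tri< u<v _ _ | no ¬u<v = contradiction u<v ¬u<v
... | tri≈ _ u≡v _ | _       = contradiction u≡v (Adj-irrefl G e)
... | tri> ¬u<v _ _ | yes u<v = contradiction u<v ¬u<v
... | tri> _ _ v<u | no _    = ∈-edges⁺ G v<u (Adj-sym G e)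

-- The values of f may give an edge in either direction, while `edges` keeps only u < v. Hence
-- `orient` normalises, and injectivity is required up to `SameEdge`.
length≤#edges : (G : Graph n) (f : A → Fin n × Fin n) {xs : List A} → Unique xs →
                (∀ {x} → x ∈ xs → uncurry (Adj G) (f x)) →
                (∀ {x y} → x ∈ xs → y ∈ xs → SameEdge (f x) (f y) → x ≡ y) →
                length xs ≤ #edges G
length≤#edges G f {xs} uniq isEdge inj = ≤-trans
  (≤-reflexive (sym (length-map (orient ∘ f) xs)))
  (length-mono-⊆ (map-unique (orient ∘ f) (λ x∈ y∈ eq → inj x∈ y∈ (orient-injective _ _ eq)) uniq)
    λ z∈ → case ∈-map⁻ (orient ∘ f) z∈ of λ { (x , x∈ , refl) → orient-∈ G (f x) (isEdge x∈) })

-- A certificate that bounds the number of edges from above, each edge being determined by its child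
-- endpoint. In the applications `xs` lists the roots of a rooted forest.
ParentMap : Graph n → List (Fin n) → (Fin n → Fin n) → Set
ParentMap G xs par = ∀ u v → Adj G u v → (u ∉ xs × v ≡ par u) ⊎ (v ∉ xs × u ≡ par v)

-- Edges go injectively to their child endpoints, and these avoid `xs`; so the children together
-- with `xs` are distinct elements of `Fin n`.
#edges-ParentMap : (G : Graph n) {xs : List (Fin n)} → Unique xs → ∀ {par} → ParentMap G xs par →
                   #edges G + length xs ≤ n
#edges-ParentMap {n} G {xs} uniq {par} pm = ≤-trans
  (≤-reflexive (trans (cong (_+ length xs) (sym (length-map child (edges G)))) (sym (length-++ (map child (edges G))))))
  (length-unique-Fin (Unique.++⁺ (map-unique child child-injective (edges-unique G)) uniq disjoint))
  where
  child′ : ∀ u v → Dec (Adj G u v) → Fin n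
  child′ u v (yes e) with pm u v e
  ... | inj₁ _ = u
  ... | inj₂ _ = v
  child′ u v (no _) = u

  child : Fin n × Fin n → Fin n
  child (u , v) = child′ u v (T? (adj G u v))

  child-spec : ∀ {u v} → (u , v) ∈ edges G → child (u , v) ∉ xs × SameEdge (u , v) (child (u , v) , par (child (u , v)))
  child-spec {u} {v} uv∈ with T? (adj G u v)
  ... | no ¬e = contradiction (proj₂ (∈-edges⁻ G uv∈)) ¬e
  ... | yes e with pm u v e
  ... | inj₁ (u∉ , eq) = u∉ , inj₁ (refl , eq)
  ... | inj₂ (v∉ , eq) = v∉ , inj₂ (eq , refl)

  child-injective : ∀ {x y} → x ∈ edges G → y ∈ edges G → child x ≡ child y → x ≡ y
  child-injective {x} {y} x∈ y∈ eq =
    SameEdge-unique (proj₂ (child-spec x∈))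
      (subst (λ c → SameEdge y (c , par c)) (sym eq) (proj₂ (child-spec y∈)))
      (proj₁ (∈-edges⁻ G x∈)) (proj₁ (∈-edges⁻ G y∈))

  disjoint : ∀ {x} → x ∈ map child (edges G) × x ∈ xs → ⊥
  disjoint (x∈ , x∈xs) with ∈-map⁻ child x∈
  ... | e , e∈ , refl = proj₁ (child-spec e∈) x∈xs

-- Connected components and a breadth-first spanning forest

module _ (G : Graph n) where

  private
    Path : Fin n → Fin n → Set
    Path = Star (Adj G)

  Path-sym : ∀ {u v} → Path u v → Path v u
  Path-sym = Star.reverse (Adj-sym G)

  -- Union-find: the edges among ps are processed one at a time, each merging two labels.
  record Labelling (ps : List (Fin n × Fin n)) : Set where
    field
      label    : Fin n → Fin n
      sound    : ∀ v → Path v (label v)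
      complete : ∀ {u v} → (u , v) ∈ ps → Adj G u v → label u ≡ label v

  labelling : ∀ ps → Labelling ps
  labelling [] = record { label = id ; sound = λ _ → ε ; complete = λ () }
  labelling ((a , b) ∷ ps) with labelling ps | T? (adj G a b)
  ... | L | no ¬e = record
    { label    = label
    ; sound    = sound
    ; complete = λ { (here refl) e → contradiction e ¬e ; (there uv∈) → complete uv∈ }
    } where open Labelling L
  ... | L | yes e = record
    { label    = λ v → merge v (label v ≟ label a)
    ; sound    = λ v → merge-sound v (label v ≟ label a)
    ; complete = λ { (here refl) _   → merged (label a ≟ label a) (label b ≟ label a)
                   ; (there uv∈) uv → merge-cong (complete uv∈ uv) (label _ ≟ label a) (label _ ≟ label a) }
    }
    where
    open Labelling L

    merge : ∀ v → Dec (label v ≡ label a) → Fin n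
    merge v (yes _) = label b
    merge v (no _)  = label v

    merge-sound : ∀ v d → Path v (merge v d)
    merge-sound v (yes eq) = (subst (Path v) eq (sound v) ◅◅ Path-sym (sound a)) ◅◅ e ◅ sound b
    merge-sound v (no _)   = sound v

    merged : ∀ d d′ → merge a d ≡ merge b d′
    merged (yes _)  (yes _) = refl
    merged (yes _)  (no _)  = refl
    merged (no a≢a) _       = contradiction refl a≢a

    merge-cong : ∀ {u v} → label u ≡ label v → ∀ d d′ → merge u d ≡ merge v d′
    merge-cong eq (yes _) (yes _) = refl
    merge-cong eq (yes p) (no ¬p) = contradiction (trans (sym eq) p) ¬p
    merge-cong eq (no ¬p) (yes p) = contradiction (trans eq p) ¬p
    merge-cong eq (no _)  (no _)  = eq

  private
    module L = Labelling (labelling (cartesianProduct (allFin n) (allFin n)))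

  -- Sealed so that later goals do not unfold the union-find over all pairs of vertices.
  abstract
    comp : Fin n → Fin n
    comp = L.label

    comp-path : ∀ v → Path v (comp v)
    comp-path = L.sound

    comp-adj : ∀ {u v} → Adj G u v → comp u ≡ comp v
    comp-adj = L.complete (∈-cartesianProduct⁺ (∈-allFin _) (∈-allFin _))

  Path⇒comp : ∀ {u v} → Path u v → comp u ≡ comp v
  Path⇒comp ε       = refl
  Path⇒comp (e ◅ p) = trans (comp-adj e) (Path⇒comp p)

  comp⇒Path : ∀ {u v} → comp u ≡ comp v → Path u v
  comp⇒Path {u} {v} eq = subst (Path u) eq (comp-path u) ◅◅ Path-sym (comp-path v)

  -- Walks of a given length are decidable, so `least` can extract a shortest walk to the root
  -- `comp v`.
  Walk : ℕ → Fin n → Fin n → Set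
  Walk zero    u v = u ≡ v
  Walk (suc k) u v = ∃[ w ] Adj G u w × Walk k w v

  Walk? : ∀ u v → Decidable (λ k → Walk k u v)
  Walk? u v zero    = u ≟ v
  Walk? u v (suc k) = any? λ w → T? (adj G u w) ×-dec Walk? w v k

  Path⇒Walk : ∀ {u v} → Path u v → ∃[ k ] Walk k u v
  Path⇒Walk ε = 0 , refl
  Path⇒Walk (e ◅ p) with Path⇒Walk p
  ... | k , walk = suc k , _ , e , walk

  shortest : ∀ v → ∃[ k ] Walk k v (comp v) × (∀ j → j < k → ¬ Walk j v (comp v))
  shortest v with Path⇒Walk (comp-path v)
  ... | k , walk = least (Walk? v (comp v)) k walk

  abstract
    depth : Fin n → ℕ
    depth v = proj₁ (shortest v)

    depth≤ : ∀ {v k} → Walk k v (comp v) → depth v ≤ k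
    depth≤ {v} walk = ≮⇒≥ λ k< → proj₂ (proj₂ (shortest v)) _ k< walk

    -- The second vertex of a shortest walk to the root has the same root, and the rest of the walk
    -- shows that it is nearer.
    towards-root : ∀ v → comp v ≢ v → ∃[ u ] Adj G v u × depth u < depth v
    towards-root v nonroot with depth v | proj₁ (proj₂ (shortest v))
    ... | zero  | v≡root         = contradiction (sym v≡root) nonroot
    ... | suc k | u , e , walk = u , e , s≤s (depth≤ (subst (Walk k u) (comp-adj e) walk))

    parent : Fin n → Fin n
    parent v with comp v ≟ v
    -- A dummy value at roots; the laws of `parent` are guarded by `comp v ≢ v`.
    ... | yes _ = v
    ... | no ne = proj₁ (towards-root v ne)

    parent-adj : ∀ {v} → comp v ≢ v → Adj G v (parent v)
    parent-adj {v} nonroot with comp v ≟ v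
    ... | yes eq = contradiction eq nonroot
    ... | no ne  = proj₁ (proj₂ (towards-root v ne))

    depth-parent : ∀ {v} → comp v ≢ v → depth (parent v) < depth v
    depth-parent {v} nonroot with comp v ≟ v
    ... | yes eq = contradiction eq nonroot
    ... | no ne  = proj₂ (proj₂ (towards-root v ne))

-- Excluding cycles by a depth function

module _ {G : Graph n} {k : ℕ} (C : Cycle G k) where
  open Cycle C

  -- The two neighbours differ because a cycle has at least three vertices: for instance, the
  -- predecessor of the last index is 1 + k, not 0.
  cycle-neighbours : ∀ i → ∃[ j ] ∃[ l ] j ≢ l × Adj G (vertex i) (vertex j) × Adj G (vertex i) (vertex l)
  cycle-neighbours zero = suc zero , fromℕ (2 + k) , (λ ()) , step zero , Adj-sym G close
  cycle-neighbours (suc i) with suc i in eq | view (suc i)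
  ... | _ | ‵fromℕ = inject₁ i , zero , ne , Adj-sym G (subst (λ j → Adj G (vertex (inject₁ i)) (vertex j)) eq (step i)) , close
    where
    ne : inject₁ i ≢ zero
    ne i≡0 with () ← trans (sym (toℕ-fromℕ (suc k)))
                       (trans (ℕ.suc-injective (cong toℕ (sym eq))) (trans (sym (toℕ-inject₁ i)) (cong toℕ i≡0)))
  ... | _ | ‵inject₁ j = inject₁ i , suc j , ne , Adj-sym G (subst (λ j → Adj G (vertex (inject₁ i)) (vertex j)) eq (step i)) , step j
    where
    ne : inject₁ i ≢ suc j
    ne i≡ = ℕ.m≢1+m+n (toℕ i) {1} (trans (trans (sym (toℕ-inject₁ i)) (cong toℕ i≡))
              (cong suc (trans (sym (toℕ-inject₁ j)) (trans (cong toℕ (sym eq)) (+-comm 1 _)))))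

-- A deepest vertex of a cycle would have both its neighbours on the cycle as its only shallower neighbour.
IsForest-depth : (G : Graph n) (d : Fin n → ℕ) →
  (∀ {u v w} → Adj G u v → Adj G u w → d v ≤ d u → d w ≤ d u → v ≡ w) → IsForest G
IsForest-depth G d unique k C with argmax (d ∘ Cycle.vertex C)
... | i , max with cycle-neighbours C i
... | j , l , j≢l , ij , il = j≢l (Cycle.injective C (unique ij il (max j) (max l)))

-- The list of asymmetric trees, including the one-vertex tree

single : AsymTree 1
single = record
  { graph      = record { adj = λ _ _ → false ; adj-sym = λ _ _ → refl ; adj-irrefl = λ _ → refl }
  ; isTree     = (zero , λ { zero zero → ε }) , λ k C → Cycle.step C zero
  ; asymmetric = λ σ → λ { zero → Fin1-unique _ }
  }
  where
  Fin1-unique : ∀ (x : Fin 1) → x ≡ zero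
  Fin1-unique zero = refl

-- Ω with the one-vertex tree put in front.
module Extended (Ω : TreeList) where

  open TreeList Ω

  order⁺ : ℕ → ℕ
  order⁺ zero    = 1
  order⁺ (suc i) = order i

  tree⁺ : ∀ i → AsymTree (order⁺ i)
  tree⁺ zero    = single
  tree⁺ (suc i) = tree i

  order⁺-positive : ∀ i → 1 ≤ order⁺ i
  order⁺-positive zero    = ≤-refl
  order⁺-positive (suc i) = <⇒≤ (nontrivial i)

  complete⁺ : (S : AsymTree m) → ∃[ i ] graph S ≅ graph (tree⁺ i)
  complete⁺ {zero} S with () ← proj₁ (proj₁ (isTree S))
  complete⁺ {suc zero} S = 0 , record
    { bij = Perm.id ; preserves = λ { zero zero → sym (adj-irrefl (graph S) zero) } }
  complete⁺ {suc (suc m)} S with complete S (s≤s (s≤s z≤n))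
  ... | i , φ = suc i , φ

  distinct⁺ : ∀ i j → graph (tree⁺ i) ≅ graph (tree⁺ j) → i ≡ j
  distinct⁺ zero    zero    φ = refl
  distinct⁺ zero    (suc j) φ = contradiction (↔⇒≡ (bij φ)) (ℕ.<⇒≢ (nontrivial j))
  distinct⁺ (suc i) zero    φ = contradiction (sym (↔⇒≡ (bij φ))) (ℕ.<⇒≢ (nontrivial i))
  distinct⁺ (suc i) (suc j) φ = cong suc (distinct i j φ)

  monotone⁺ : ∀ {i j} → i ≤ j → order⁺ i ≤ order⁺ j
  monotone⁺ {j = j} z≤n = order⁺-positive j
  monotone⁺ {suc i} {suc j} (s≤s i≤j) with i ℕ.≟ j
  ... | yes refl = ≤-refl
  ... | no  i≢j  = monotone i j (ℕ.≤∧≢⇒< i≤j i≢j)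

  -- k is the largest number of distinct asymmetric trees with at most n vertices in total.
  Maximal : ℕ → ℕ → Set
  Maximal n k = sum< order⁺ k ≤ n × n < sum< order⁺ (suc k)

  -- Bounds the number of tree components of an asymmetric graph. Used in both directions, it also
  -- shows that `Maximal n` determines k.
  Maximal-greatest : ∀ {n k t} → Maximal n k → sum< order⁺ t ≤ n → t ≤ k
  Maximal-greatest (_ , n<) t≤n = ≮⇒≥ λ k<t → <⇒≱ n< (≤-trans (sum<-mono-≤ order⁺ k<t) t≤n)

-- The lower bound: components of an asymmetric graph

induced : Graph n → (Fin m → Fin n) → Graph m
induced G f = record
  { adj        = λ x y → adj G (f x) (f y)
  ; adj-sym    = λ x y → adj-sym G (f x) (f y)
  ; adj-irrefl = λ x → adj-irrefl G (f x)
  }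

module Components (G : Graph n) where

  members : Fin n → List (Fin n)
  members r = filter (λ v → comp G v ≟ r) (allFin n)

  members-unique : ∀ r → Unique (members r)
  members-unique r = Unique.filter⁺ _ (Unique.allFin⁺ n)

  ∈-members⁻ : ∀ {v r} → v ∈ members r → comp G v ≡ r
  ∈-members⁻ {r = r} v∈ = proj₂ (∈-filter⁻ (λ v → comp G v ≟ r) {xs = allFin n} v∈)

  ∈-members⁺ : ∀ {v r} → comp G v ≡ r → v ∈ members r
  ∈-members⁺ {v} {r} eq = ∈-filter⁺ (λ v → comp G v ≟ r) (∈-allFin v) eq

  size : Fin n → ℕ
  size r = length (members r)

  place : ∀ r → Fin (size r) → Fin n
  place r = lookup (members r)

  place-injective : ∀ r {x y} → place r x ≡ place r y → x ≡ y
  place-injective r {x} {y} = lookup-injective (members-unique r) x y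

  comp-place : ∀ r x → comp G (place r x) ≡ r
  comp-place r x = ∈-members⁻ (∈-lookup x)

  locate : ∀ {r} v → comp G v ≡ r → Fin (size r)
  locate v eq = Any.index (∈-members⁺ eq)

  place-locate : ∀ {r} v (eq : comp G v ≡ r) → place r (locate v eq) ≡ v
  place-locate v eq = sym (lookup-index (∈-members⁺ eq))

  locate-place : ∀ {r} x (eq : comp G (place r x) ≡ r) → locate (place r x) eq ≡ x
  locate-place {r} x eq = place-injective r (place-locate (place r x) eq)

  component : ∀ r → Graph (size r)
  component r = induced G (place r)

  transport : ∀ r s → Permutation (size r) (size s) → ∀ v → comp G v ≡ r → Fin n
  transport r s π v eq = place s (π ⟨$⟩ʳ locate v eq)

  -- Exchanges the components r and s along π and fixes the rest. The test for r comes first, so r =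
  -- s gives π on that one component. The decisions are arguments so that the laws below can split
  -- on arbitrary ones.
  move : ∀ r s → Permutation (size r) (size s) → ∀ v → Dec (comp G v ≡ r) → Dec (comp G v ≡ s) → Fin n
  move r s π v (yes p) _       = transport r s π v p
  move r s π v (no _)  (yes q) = transport s r (Perm.flip π) v q
  move r s π v (no _)  (no _)  = v

  transport-transport : ∀ r s (π : Permutation (size r) (size s)) v p q →
                        transport s r (Perm.flip π) (transport r s π v p) q ≡ v
  transport-transport r s π v p q = trans
    (cong (λ x → place r (π ⟨$⟩ˡ x)) (locate-place _ q))
    (trans (cong (place r) (inverseˡ (π))) (place-locate v p))

  move-move : ∀ r s (π : Permutation (size r) (size s)) v d d′ e e′ →
              move s r (Perm.flip π) (move r s π v d d′) e e′ ≡ v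
  move-move r s π v (yes p) _ (yes q) _ = transport-transport r s π v p q
  move-move r s π v (yes p) _ (no ¬q) _ = contradiction (comp-place s _) ¬q
  move-move r s π v (no ¬p) (yes q) (yes q′) _ =
    contradiction (trans q (trans (sym q′) (comp-place r _))) ¬p
  move-move r s π v (no ¬p) (yes q) (no _) (yes p′) = transport-transport s r (Perm.flip π) v q p′
  move-move r s π v (no ¬p) (yes q) (no _) (no ¬p′) = contradiction (comp-place r _) ¬p′
  move-move r s π v (no ¬p) (no ¬q) (yes q) _ = contradiction q ¬q
  move-move r s π v (no ¬p) (no ¬q) (no _) (yes p) = contradiction p ¬p
  move-move r s π v (no ¬p) (no ¬q) (no _) (no _) = refl

  transport-adj : ∀ r s (φ : component r ≅ component s) {u v} p q → Adj G u v →
                  Adj G (transport r s (bij φ) u p) (transport r s (bij φ) v q)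
  transport-adj r s φ {u} {v} p q e = subst T (sym (trans
    (preserves φ (locate u p) (locate v q))
    (cong₂ (adj G) (place-locate u p) (place-locate v q)))) e

  move-adj : ∀ r s (φ : component r ≅ component s) {u v} d d′ e e′ → Adj G u v →
             Adj G (move r s (bij φ) u d d′) (move r s (bij φ) v e e′)
  move-adj r s φ (yes p) _ (yes q) _ uv = transport-adj r s φ p q uv
  move-adj r s φ (yes p) _ (no ¬q) _ uv = contradiction (trans (sym (comp-adj G uv)) p) ¬q
  move-adj r s φ (no ¬p) _ (yes q) _ uv = contradiction (trans (comp-adj G uv) q) ¬p
  move-adj r s φ (no _) (yes p) (no _) (yes q) uv = transport-adj s r (≅-sym φ) p q uv
  move-adj r s φ (no _) (yes p) (no _) (no ¬q) uv = contradiction (trans (sym (comp-adj G uv)) p) ¬q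
  move-adj r s φ (no _) (no ¬p) (no _) (yes q) uv = contradiction (trans (comp-adj G uv) q) ¬p
  move-adj r s φ (no _) (no _) (no _) (no _) uv = uv

  moveTo : ∀ r s → Permutation (size r) (size s) → Fin n → Fin n
  moveTo r s π v = move r s π v (comp G v ≟ r) (comp G v ≟ s)

  moveTo-moveTo : ∀ r s π v → moveTo s r (Perm.flip π) (moveTo r s π v) ≡ v
  moveTo-moveTo r s π v = move-move r s π v (comp G v ≟ r) (comp G v ≟ s) (comp G v′ ≟ s) (comp G v′ ≟ r)
    where v′ = moveTo r s π v

  moveTo-adj : ∀ r s (φ : component r ≅ component s) u v → Adj G u v →
               Adj G (moveTo r s (bij φ) u) (moveTo r s (bij φ) v)
  moveTo-adj r s φ u v = move-adj r s φ (comp G u ≟ r) (comp G u ≟ s) (comp G v ≟ r) (comp G v ≟ s)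

  -- An isomorphism between two components, extended by its inverse and the identity.
  extension : ∀ r s → component r ≅ component s → Automorphism G
  extension r s φ = record
    { bij       = Perm.permutation (moveTo r s π) (moveTo s r (Perm.flip π))
                    (moveTo-moveTo s r (Perm.flip π)) (moveTo-moveTo r s π)
    ; preserves = λ u v → T-ext
        (λ e → subst T (cong₂ (adj G) (moveTo-moveTo r s π u) (moveTo-moveTo r s π v))
                 (moveTo-adj s r (≅-sym φ) _ _ e))
        (moveTo-adj r s φ u v)
    }
    where π = bij φ

  moveTo-source : ∀ r s (π : Permutation (size r) (size s)) x → moveTo r s π (place r x) ≡ place s (π ⟨$⟩ʳ x)
  moveTo-source r s π x with comp G (place r x) ≟ r
  ... | yes p = cong (λ y → place s (π ⟨$⟩ʳ y)) (locate-place x p)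
  ... | no ¬p = contradiction (comp-place r x) ¬p

  module _ (asym : Asymmetric G) where

    component-asymmetric : ∀ r → Asymmetric (component r)
    component-asymmetric r φ x = place-injective r
      (trans (sym (moveTo-source r r (bij φ) x)) (asym (extension r r φ) (place r x)))

    -- The extension of φ is the identity by asymmetry, so a vertex of component r lies in component
    -- s. Such a vertex exists because r is a root.
    component-distinct : ∀ r s → comp G r ≡ r → component r ≅ component s → r ≡ s
    component-distinct r s root φ = begin
      r                                       ≡⟨ comp-place r x ⟨
      comp G (place r x)                      ≡⟨ cong (comp G) (asym (extension r s φ) (place r x)) ⟨
      comp G (moveTo r s (bij φ) (place r x))       ≡⟨ cong (comp G) (moveTo-source r s (bij φ) x) ⟩
      comp G (place s (bij φ ⟨$⟩ʳ x))         ≡⟨ comp-place s _ ⟩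
      s                                       ∎
      where
      open ≡-Reasoning
      x = locate r root

  -- The edges of the breadth-first forest given by `parent`. Components all of whose edges are of
  -- this kind are recognised below as trees, by a decidable test.
  TreeEdge : Fin n → Fin n → Set
  TreeEdge u v = (comp G v ≢ v × u ≡ parent G v) ⊎ (comp G u ≢ u × v ≡ parent G u)

  TreeEdge? : ∀ u v → Dec (TreeEdge u v)
  TreeEdge? u v = (¬? (comp G v ≟ v) ×-dec (u ≟ parent G v)) ⊎-dec (¬? (comp G u ≟ u) ×-dec (v ≟ parent G u))

  ExtraEdge : Fin n → Set
  ExtraEdge r = ∃[ u ] ∃[ v ] comp G u ≡ r × Adj G u v × ¬ TreeEdge u v

  ExtraEdge? : Decidable ExtraEdge
  ExtraEdge? r = any? λ u → any? λ v → (comp G u ≟ r) ×-dec T? (adj G u v) ×-dec ¬? (TreeEdge? u v)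

  TreeRoot : Fin n → Set
  TreeRoot r = comp G r ≡ r × ¬ ExtraEdge r

  TreeRoot? : Decidable TreeRoot
  TreeRoot? r = (comp G r ≟ r) ×-dec ¬? (ExtraEdge? r)

  component-path : ∀ {r u v} → Star (Adj G) u v → ∀ x y → place r x ≡ u → place r y ≡ v →
                   Star (Adj (component r)) x y
  component-path {r} ε x y refl eq with refl ← place-injective r eq = ε
  component-path {r} (_◅_ {j = w} e p) x y refl eq =
    subst (Adj G (place r x)) (sym (place-locate w w∈)) e ◅ component-path p (locate w w∈) y (place-locate w w∈) eq
    where w∈ = trans (sym (comp-adj G e)) (comp-place r x)

  -- Without extra edges every edge joins a vertex to its parent, which is strictly shallower. The
  -- parent is thus the only neighbour that is not deeper, and `IsForest-depth` applies.
  component-isTree : ∀ {r} → TreeRoot r → IsTree (component r)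
  component-isTree {r} (root , ¬extra) =
    (locate r root , λ x y → component-path (comp⇒Path G (trans (comp-place r x) (sym (comp-place r y)))) x y refl refl)
    , IsForest-depth (component r) (depth G ∘ place r) λ e e′ dv≤ dw≤ →
        place-injective r (trans (isParent e dv≤) (sym (isParent e′ dw≤)))
    where
    isParent : ∀ {x y} → Adj (component r) x y → depth G (place r y) ≤ depth G (place r x) →
               place r y ≡ parent G (place r x)
    isParent {x} {y} e dy≤ with decidable-stable (TreeEdge? (place r x) (place r y))
                          (λ ¬te → ¬extra (place r x , place r y , comp-place r x , e , ¬te))
    ... | inj₁ (nonroot , eq) = contradiction dy≤
      (<⇒≱ (subst (λ z → depth G z < depth G (place r y)) (sym eq) (depth-parent G nonroot)))
    ... | inj₂ (_ , eq) = eq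

  -- A non-root is charged to its parent edge, the root of a component that is not a tree to an extra edge.
  charge : Fin n → Fin n × Fin n
  charge v with comp G v ≟ v | ExtraEdge? v
  ... | no _  | _                 = v , parent G v
  ... | yes _ | yes (u , w , _)   = u , w
  -- A dummy value at the root of a tree component, a case that `charge-spec` excludes.
  ... | yes _ | no _              = v , v

  Charged : Fin n → Fin n × Fin n → Set
  Charged v p = (comp G v ≢ v × p ≡ (v , parent G v)) ⊎ (comp G (proj₁ p) ≡ v × ¬ uncurry TreeEdge p)

  charge-spec : ∀ {v} → ¬ TreeRoot v → uncurry (Adj G) (charge v) × Charged v (charge v)
  charge-spec {v} ¬root with comp G v ≟ v | ExtraEdge? v
  ... | no nonroot | _         = parent-adj G nonroot , inj₁ (nonroot , refl)
  ... | yes _ | yes (u , w , eq , e , ¬te) = e , inj₂ (eq , ¬te)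
  ... | yes root | no ¬extra   = contradiction (root , ¬extra) ¬root

  parent-asym : ∀ {u v} → comp G u ≢ u → comp G v ≢ v → u ≡ parent G v → v ≢ parent G u
  parent-asym {u} {v} nru nrv u≡pv v≡pu = ℕ.<-asym
    (subst (λ z → depth G z < depth G v) (sym u≡pv) (depth-parent G nrv))
    (subst (λ z → depth G z < depth G u) (sym v≡pu) (depth-parent G nru))

  charged-edge : ∀ {v q} → comp G v ≢ v → SameEdge (v , parent G v) q → uncurry TreeEdge q
  charged-edge nonroot (inj₁ (refl , refl)) = inj₂ (nonroot , refl)
  charged-edge nonroot (inj₂ (refl , refl)) = inj₁ (nonroot , refl)

  SameEdge-sym : {p q : Fin n × Fin n} → SameEdge p q → SameEdge q p
  SameEdge-sym (inj₁ (refl , refl)) = inj₁ (refl , refl)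
  SameEdge-sym (inj₂ (refl , refl)) = inj₂ (refl , refl)

  -- Two parent edges coincide only for the same child, since parents are strictly shallower; a
  -- parent edge is never an extra edge; and equal extra edges lie in the same component, hence have
  -- the same root.
  charged-injective : ∀ {u v p q} → uncurry (Adj G) p → Charged u p → Charged v q → SameEdge p q → u ≡ v
  charged-injective _ (inj₁ (nu , refl)) (inj₁ (nv , refl)) (inj₁ (u≡v , _)) = u≡v
  charged-injective _ (inj₁ (nu , refl)) (inj₁ (nv , refl)) (inj₂ (u≡pv , pu≡v)) =
    contradiction (sym pu≡v) (parent-asym nu nv u≡pv)
  charged-injective _ (inj₁ (nu , refl)) (inj₂ (_ , ¬te)) same = contradiction (charged-edge nu same) ¬te
  charged-injective _ (inj₂ (_ , ¬te)) (inj₁ (nv , refl)) same =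
    contradiction (charged-edge nv (SameEdge-sym same)) ¬te
  charged-injective _ (inj₂ (u≡ , _)) (inj₂ (v≡ , _)) (inj₁ (refl , refl)) = trans (sym u≡) v≡
  charged-injective e (inj₂ (u≡ , _)) (inj₂ (v≡ , _)) (inj₂ (refl , refl)) =
    trans (sym u≡) (trans (comp-adj G e) v≡)

  -- Here t is the number of tree components. Charging the other vertices to edges gives n ≤
  -- `#edges G` + t. The tree components have distinct indices in the extended list, so
  -- `sum-distinct` bounds their total order from below, and disjointness bounds it by n.
  lower-bound : (Ω : TreeList) → Asymmetric G → let open Extended Ω in
                ∃[ t ] sum< order⁺ t ≤ n × n ≤ #edges G + t
  lower-bound Ω asym = length roots , fits , enough
    where
    open Extended Ω

    roots = filter TreeRoot? (allFin n)
    nonroots = filter (¬? ∘ TreeRoot?) (allFin n)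

    enough : n ≤ #edges G + length roots
    enough = ≤-trans
      (≤-reflexive (trans (sym (length-tabulate {n = n} id)) (length-filter-¬ TreeRoot? (allFin n))))
      (+-monoˡ-≤ (length roots) (length≤#edges G charge (Unique.filter⁺ _ (Unique.allFin⁺ n))
        (λ v∈ → proj₁ (spec v∈))
        (λ u∈ v∈ → charged-injective (proj₁ (spec u∈)) (proj₂ (spec u∈)) (proj₂ (spec v∈)))))
      where
      spec : ∀ {v} → v ∈ nonroots → uncurry (Adj G) (charge v) × Charged v (charge v)
      spec v∈ = charge-spec (proj₂ (∈-filter⁻ (¬? ∘ TreeRoot?) {xs = allFin n} v∈))

    asymTree : ∀ {r} → TreeRoot r → AsymTree (size r)
    asymTree {r} root = record
      { graph = component r ; isTree = component-isTree root ; asymmetric = component-asymmetric asym r }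

    index⁺ : Fin n → ℕ
    index⁺ r with TreeRoot? r
    ... | yes root = proj₁ (complete⁺ (asymTree root))
    -- A dummy index; the laws of `index⁺` are restricted to `roots`.
    ... | no _     = 0

    index⁺-iso : ∀ {r} → r ∈ roots → component r ≅ graph (tree⁺ (index⁺ r))
    index⁺-iso {r} r∈ with TreeRoot? r
    ... | yes root = proj₂ (complete⁺ (asymTree root))
    ... | no ¬root = contradiction (proj₂ (∈-filter⁻ TreeRoot? {xs = allFin n} r∈)) ¬root

    index⁺-injective : ∀ {r s} → r ∈ roots → s ∈ roots → index⁺ r ≡ index⁺ s → r ≡ s
    index⁺-injective {r} {s} r∈ s∈ eq =
      component-distinct asym r s (proj₁ (proj₂ (∈-filter⁻ TreeRoot? {xs = allFin n} r∈)))
        (≅-trans (index⁺-iso r∈) (subst (λ i → graph (tree⁺ i) ≅ component s) (sym eq) (≅-sym (index⁺-iso s∈))))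

    sum-orders : ∀ {rs} → (∀ {r} → r ∈ rs → r ∈ roots) →
                 sum (map order⁺ (map index⁺ rs)) ≡ length (concat (map members rs))
    sum-orders {[]}     sub = refl
    sum-orders {r ∷ rs} sub = trans
      (cong₂ _+_ (sym (↔⇒≡ (bij (index⁺-iso (sub (here refl)))))) (sum-orders (sub ∘ there)))
      (sym (length-++ (members r)))

    members-disjoint : ∀ {rs} → Unique rs → AllPairs Disjoint (map members rs)
    members-disjoint [] = []
    members-disjoint (r≢ ∷ uniq) = AllP.map⁺ (All.map (λ r≢s {v} → λ { (v∈r , v∈s) → r≢s (trans (sym (∈-members⁻ v∈r)) (∈-members⁻ v∈s)) }) r≢)
      ∷ members-disjoint uniq

    roots-unique : Unique roots
    roots-unique = Unique.filter⁺ TreeRoot? (Unique.allFin⁺ n)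

    fits : sum< order⁺ (length roots) ≤ n
    fits = begin
      sum< order⁺ (length roots)              ≤⟨ sum-distinct monotone⁺ (length roots) (length-map index⁺ roots)
                                                   (map-unique index⁺ index⁺-injective roots-unique) ⟩
      sum (map order⁺ (map index⁺ roots))     ≡⟨ sum-orders id ⟩
      length (concat (map members roots))     ≤⟨ length-unique-Fin (Unique.concat⁺
                                                   (AllP.map⁺ (All.tabulate λ {r} _ → members-unique r))
                                                   (members-disjoint roots-unique)) ⟩
      n                                       ∎
      where open ℕ.≤-Reasoning

-- Trees as sequences of leaf additions

Cycle-map : {G : Graph m} {H : Graph n} (f : Fin m → Fin n) → Injective _≡_ _≡_ f →
            (∀ {u v} → Adj G u v → Adj H (f u) (f v)) → ∀ {k} → Cycle G k → Cycle H k
Cycle-map f f-inj f-adj C = record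
  { vertex    = f ∘ vertex
  ; injective = injective ∘ f-inj
  ; step      = f-adj ∘ step
  ; close     = f-adj close
  } where open Cycle C

module _ (G : Graph n) where

  Leaf : Fin n → Fin n → Set
  Leaf v u = Adj G v u × (∀ w → Adj G v w → w ≡ u)

  Leaf? : ∀ v u → Dec (Leaf v u)
  Leaf? v u = T? (adj G v u) ×-dec all? (λ w → T? (adj G v w) →-dec (w ≟ u))

  -- Without leaves there is a walk that never backtracks; its first repetition closes a cycle.
  module Leafless (leafless : ¬ (∃[ v ] ∃[ u ] Leaf v u)) (start : ∃[ u ] ∃[ v ] Adj G u v) where

    turn : ∀ u v → Adj G u v → ∃[ w ] Adj G v w × w ≢ u
    turn u v e with any? (λ w → T? (adj G v w) ×-dec ¬? (w ≟ u))
    ... | yes found = found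
    ... | no ¬found = contradiction
      (v , u , Adj-sym G e , λ w vw → decidable-stable (w ≟ u) λ w≢u → ¬found (w , vw , w≢u)) leafless

    -- The state of the walk is a directed edge, since the next step must avoid the vertex just
    -- left.
    arc : ℕ → ∃[ u ] ∃[ v ] Adj G u v
    arc zero    = start
    arc (suc k) = let u , v , e = arc k ; w , vw , _ = turn u v e in v , w , vw

    pos : ℕ → Fin n
    pos k = proj₁ (arc k)

    pos-adj : ∀ k → Adj G (pos k) (pos (suc k))
    pos-adj k = proj₂ (proj₂ (arc k))

    pos-turn : ∀ k → pos (suc (suc k)) ≢ pos k
    pos-turn k = let u , v , e = arc k in proj₂ (proj₂ (turn u v e))

    Repeats : ℕ → Set
    Repeats j = ∃[ i ] i < j × pos i ≡ pos j

    Repeats? : Decidable Repeats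
    Repeats? j = ℕ.anyUpTo? (λ i → pos i ≟ pos j) j

    repeats : ∃[ j ] Repeats j
    repeats with Fin.pigeonhole (ℕ.n<1+n n) (pos ∘ toℕ)
    ... | i , j , i<j , eq = toℕ j , toℕ i , i<j , eq

    -- The repetition closes up after 1 + o steps. One step would be a loop and two would be a
    -- backtracking; 3 + k steps give a cycle, whose vertices are distinct because the repetition is
    -- the first.
    closes : ∀ i o → pos i ≡ pos (suc (i + o)) → (∀ j → j < suc (i + o) → ¬ Repeats j) → ∃[ k ] Cycle G k
    closes i zero eq _ = contradiction (trans eq (cong (pos ∘ suc) (+-identityʳ i))) (Adj-irrefl G (pos-adj i))
    closes i (suc zero) eq _ = contradiction (sym (trans eq (cong (pos ∘ suc) (+-comm i 1)))) (pos-turn i)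
    closes i (suc (suc k)) eq first = k , record
      { vertex    = λ t → pos (i + toℕ t)
      ; injective = λ {s} {t} → inj s t
      ; step      = λ t → subst (Adj G (pos (i + toℕ (inject₁ t))))
                            (cong pos (trans (cong (λ x → suc (i + x)) (toℕ-inject₁ t)) (sym (+-suc i (toℕ t)))))
                            (pos-adj (i + toℕ (inject₁ t)))
      ; close     = subst (Adj G (pos (i + toℕ (fromℕ (2 + k)))))
                      (trans (cong (λ x → pos (suc (i + x))) (toℕ-fromℕ (2 + k))) (trans (sym eq) (cong pos (sym (+-identityʳ i)))))
                      (pos-adj (i + toℕ (fromℕ (2 + k))))
      }
      where
      distinct : ∀ (s t : Fin (3 + k)) → toℕ s < toℕ t → pos (i + toℕ s) ≢ pos (i + toℕ t)
      distinct s t s<t same = first (i + toℕ t)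
        (s≤s (+-monoʳ-≤ i (ℕ.≤-pred (toℕ<n t))))
        (i + toℕ s , ℕ.+-monoʳ-< i s<t , same)

      inj : ∀ (s t : Fin (3 + k)) → pos (i + toℕ s) ≡ pos (i + toℕ t) → s ≡ t
      inj s t same with ℕ.<-cmp (toℕ s) (toℕ t)
      ... | tri< s<t _ _ = contradiction same (distinct s t s<t)
      ... | tri≈ _ eq _  = toℕ-injective eq
      ... | tri> _ _ t<s = contradiction (sym same) (distinct t s t<s)

    cycle : ∃[ k ] Cycle G k
    cycle with least Repeats? (proj₁ repeats) (proj₂ repeats)
    ... | j , (i , i<j , eq) , first with ℕ.m≤n⇒∃[o]m+o≡n i<j
    ... | o , refl = closes i o eq first

  leaf-exists : IsForest G → ∃[ u ] ∃[ v ] Adj G u v → ∃[ v ] ∃[ u ] Leaf v u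
  leaf-exists forest start with any? (λ v → any? (Leaf? v))
  ... | yes leaf = leaf
  ... | no ¬leaf = let k , C = Leafless.cycle ¬leaf start in contradiction C (forest k)

connected-edge : (G : Graph (suc (suc m))) → Connected G → ∃[ u ] ∃[ v ] Adj G u v
connected-edge G (_ , path) with path zero (suc zero)
... | e ◅ _ = _ , _ , e

module _ (G : Graph (suc n)) {v u : Fin (suc n)} (leaf : Leaf G v u) where

  private
    v≢u : v ≢ u
    v≢u = Adj-irrefl G (proj₁ leaf)

  stalk : Fin n
  stalk = punchOut v≢u

  withoutLeaf : Graph n
  withoutLeaf = induced G (punchIn v)

  -- Folds the leaf onto its neighbour. Paths of G become paths of `withoutLeaf`, so deleting a leaf
  -- preserves connectedness.
  retract : ∀ w → Dec (v ≡ w) → Fin n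
  retract w (yes _)  = stalk
  retract w (no v≢w) = punchOut v≢w

  retract-punchIn : ∀ x d → retract (punchIn v x) d ≡ x
  retract-punchIn x (yes v≡) = contradiction (sym v≡) (Fin.punchInᵢ≢i v x)
  retract-punchIn x (no v≢)  = Fin.punchIn-injective v _ _ (Fin.punchIn-punchOut v≢)

  retract-adj : ∀ {w w′} → Adj G w w′ → ∀ d d′ → Star (Adj withoutLeaf) (retract w d) (retract w′ d′)
  retract-adj e (yes _) (yes _) = ε
  retract-adj {w′ = w′} e (yes refl) (no v≢w′) =
    subst (Star (Adj withoutLeaf) stalk) (Fin.punchOut-cong v (sym (proj₂ leaf w′ e))) ε
  retract-adj {w} e (no v≢w) (yes refl) =
    subst (λ x → Star (Adj withoutLeaf) x stalk) (Fin.punchOut-cong v (sym (proj₂ leaf w (Adj-sym G e)))) ε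
  retract-adj e (no v≢w) (no v≢w′) =
    subst T (cong₂ (adj G) (sym (Fin.punchIn-punchOut v≢w)) (sym (Fin.punchIn-punchOut v≢w′))) e ◅ ε

  retract-path : ∀ {w w′} → Star (Adj G) w w′ → ∀ d d′ → Star (Adj withoutLeaf) (retract w d) (retract w′ d′)
  retract-path {w} ε (yes _) (yes _)  = ε
  retract-path ε (yes p) (no ¬p) = contradiction p ¬p
  retract-path ε (no ¬p) (yes p) = contradiction p ¬p
  retract-path ε (no ¬p) (no _)  = subst (Star (Adj withoutLeaf) (punchOut ¬p)) (Fin.punchOut-cong v refl) ε
  retract-path (_◅_ {j = w} e p) d d′ = retract-adj e d (v ≟ w) ◅◅ retract-path p (v ≟ w) d′

  withoutLeaf-isTree : IsTree G → IsTree withoutLeaf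
  withoutLeaf-isTree ((_ , path) , forest) =
    (stalk , λ x y → subst₂ (Star (Adj withoutLeaf)) (retract-punchIn x (v ≟ _)) (retract-punchIn y (v ≟ _))
                       (retract-path (path (punchIn v x) (punchIn v y)) (v ≟ _) (v ≟ _))) ,
    λ k → forest k ∘ Cycle-map (punchIn v) (λ {x} {y} → Fin.punchIn-injective v x y) id

addLeaf : Graph n → Fin n → Graph (suc n)
addLeaf {n} G u = record
  { adj        = adj′
  ; adj-sym    = λ { zero zero → refl ; zero (suc y) → refl ; (suc x) zero → refl ; (suc x) (suc y) → adj-sym G x y }
  ; adj-irrefl = λ { zero → refl ; (suc x) → adj-irrefl G x }
  }
  where
  adj′ : Fin (suc n) → Fin (suc n) → Bool
  adj′ zero    zero    = false
  adj′ zero    (suc y) = does (y ≟ u)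
  adj′ (suc x) zero    = does (x ≟ u)
  adj′ (suc x) (suc y) = adj G x y

insert-self : ∀ i j (π : Permutation m n) → Perm.insert i j π ⟨$⟩ʳ i ≡ j
insert-self i j π with i ≟ i
... | yes _ = refl
... | no ne = contradiction refl ne

Permutation-injective : (π : Permutation m n) → Injective _≡_ _≡_ (π ⟨$⟩ʳ_)
Permutation-injective π eq = trans (sym (inverseˡ π)) (trans (cong (π ⟨$⟩ˡ_) eq) (inverseˡ π))

≅-addLeaf : (G : Graph (suc n)) {v u : Fin (suc n)} (leaf : Leaf G v u) {H : Graph n}
            (φ : withoutLeaf G leaf ≅ H) → G ≅ addLeaf H (bij φ ⟨$⟩ʳ stalk G leaf)
≅-addLeaf {n} G {v} {u} leaf {H} φ = record { bij = π ; preserves = λ x y → pres x y (v ≟ x) (v ≟ y) }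
  where
  π = Perm.insert v zero (bij φ)
  s = bij φ ⟨$⟩ʳ stalk G leaf
  H⁺ = addLeaf H s

  πv : π ⟨$⟩ʳ v ≡ zero
  πv = insert-self v zero (bij φ)

  πp : ∀ {x} (v≢x : v ≢ x) → π ⟨$⟩ʳ x ≡ suc (bij φ ⟨$⟩ʳ punchOut v≢x)
  πp v≢x = trans (cong (π ⟨$⟩ʳ_) (sym (Fin.punchIn-punchOut v≢x))) (Perm.insert-punchIn v zero (bij φ) (punchOut v≢x))

  stalk-adj : ∀ {y} (v≢y : v ≢ y) → does ((bij φ ⟨$⟩ʳ punchOut v≢y) ≟ s) ≡ adj G v y
  stalk-adj {y} v≢y = T-ext
    (λ t → subst (Adj G v) (sym (Fin.punchOut-injective v≢y _ (Permutation-injective (bij φ) (does⁻ (_ ≟ _) t)))) (proj₁ leaf))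
    (λ e → does⁺ (_ ≟ _) (cong (bij φ ⟨$⟩ʳ_) (Fin.punchOut-cong v (proj₂ leaf y e))))

  pres : ∀ x y → Dec (v ≡ x) → Dec (v ≡ y) → adj H⁺ (π ⟨$⟩ʳ x) (π ⟨$⟩ʳ y) ≡ adj G x y
  pres x y (yes refl) (yes refl) = trans (adj-irrefl H⁺ (π ⟨$⟩ʳ v)) (sym (adj-irrefl G v))
  pres x y (yes refl) (no v≢y) = trans (cong₂ (adj H⁺) πv (πp v≢y)) (stalk-adj v≢y)
  pres x y (no v≢x) (yes refl) = trans (cong₂ (adj H⁺) (πp v≢x) πv) (trans (stalk-adj v≢x) (adj-sym G v x))
  pres x y (no v≢x) (no v≢y) = trans (cong₂ (adj H⁺) (πp v≢x) (πp v≢y))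
    (trans (preserves φ _ _) (cong₂ (adj G) (Fin.punchIn-punchOut v≢x) (Fin.punchIn-punchOut v≢y)))

-- A tree on Fin (suc m), built from a single vertex by adding m leaves.
Code : ℕ → Set
Code zero    = ⊤
Code (suc m) = Fin (suc m) × Code m

decode : ∀ m → Code m → Graph (suc m)
decode zero    _       = graph single
decode (suc m) (u , c) = addLeaf (decode m c) u

-- Leaves are removed until one vertex is left. Codes serve twice: they make the trees of small
-- order a finite search, and they provide a parent map for every tree.
encode : (G : Graph (suc m)) → IsTree G → ∃[ c ] G ≅ decode m c
encode {zero} G _ = tt , record { bij = Perm.id ; preserves = λ { zero zero → sym (adj-irrefl G zero) } }
encode {suc m} G isTree with leaf-exists G (proj₂ isTree) (connected-edge G (proj₁ isTree))
... | v , u , leaf with encode (withoutLeaf G leaf) (withoutLeaf-isTree G leaf isTree)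
... | c , φ = (_ , c) , ≅-addLeaf G leaf φ

-- A leaf has as parent the vertex to which it was attached; the root is the initial vertex,
-- renumbered by each addition.
decode-ParentMap : ∀ m (c : Code m) → ∃[ r ] ∃[ par ] ParentMap (decode m c) (r ∷ []) par
decode-ParentMap zero    _       = zero , id , λ _ _ ()
decode-ParentMap (suc m) (w , c) with decode-ParentMap m c
... | r , par , pm = suc r , par⁺ , pm⁺
  where
  par⁺ : Fin (suc (suc m)) → Fin (suc (suc m))
  par⁺ zero    = suc w
  par⁺ (suc x) = suc (par x)

  suc∉ : ∀ {x} → x ∉ r ∷ [] → suc x ∉ suc r ∷ []
  suc∉ x∉ (here eq) = x∉ (here (Fin.suc-injective eq))

  zero∉ : zero ∉ suc r ∷ []
  zero∉ (here ())

  pm⁺ : ParentMap (decode (suc m) (w , c)) (suc r ∷ []) par⁺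
  pm⁺ zero    (suc y) e = inj₁ (zero∉ , cong suc (does⁻ (_ ≟ w) e))
  pm⁺ (suc x) zero    e = inj₂ (zero∉ , cong suc (does⁻ (_ ≟ w) e))
  pm⁺ (suc x) (suc y) e with pm x y e
  ... | inj₁ (x∉ , eq) = inj₁ (suc∉ x∉ , cong suc eq)
  ... | inj₂ (y∉ , eq) = inj₂ (suc∉ y∉ , cong suc eq)

≅-adj : {G : Graph m} {H : Graph n} (φ : G ≅ H) → ∀ {u v} → Adj G u v → Adj H (bij φ ⟨$⟩ʳ u) (bij φ ⟨$⟩ʳ v)
≅-adj φ {u} {v} = subst T (sym (preserves φ u v))

≅-adj⁻ : {G : Graph m} {H : Graph n} (φ : G ≅ H) → ∀ {u v} → Adj H (bij φ ⟨$⟩ʳ u) (bij φ ⟨$⟩ʳ v) → Adj G u v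
≅-adj⁻ φ {u} {v} = subst T (preserves φ u v)

tree-ParentMap : (G : Graph n) → IsTree G → ∃[ r ] ∃[ par ] ParentMap G (r ∷ []) par
tree-ParentMap {zero} G ((() , _) , _)
tree-ParentMap {suc m} G isTree with encode G isTree
... | c , φ with decode-ParentMap m c
... | r , par , pm = π⁻¹ r , π⁻¹ ∘ par ∘ π , pmG
  where
  π   = bij φ ⟨$⟩ʳ_
  π⁻¹ = bij φ ⟨$⟩ˡ_

  ∉-transfer : ∀ {x} → π x ∉ r ∷ [] → x ∉ π⁻¹ r ∷ []
  ∉-transfer πx∉ (here refl) = πx∉ (here (inverseʳ (bij φ)))

  pmG : ParentMap G (π⁻¹ r ∷ []) (π⁻¹ ∘ par ∘ π)
  pmG u v e with pm (π u) (π v) (≅-adj φ e)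
  ... | inj₁ (u∉ , eq) = inj₁ (∉-transfer u∉ , trans (sym (inverseˡ (bij φ))) (cong π⁻¹ eq))
  ... | inj₂ (v∉ , eq) = inj₂ (∉-transfer v∉ , trans (sym (inverseˡ (bij φ))) (cong π⁻¹ eq))

-- An asymmetric tree of every order from 7 on

-- The spider with legs 1, 2 and 3 + j: vertex 0 is joined to 3, and 1, 2, 3, … is a path.
module Spider (j : ℕ) where

  private
    V = Fin (7 + j)

  -- Every vertex except the last, 6 + j, has `next` as its only larger neighbour. All edges thus
  -- point to the end of the long leg, which gives connectedness, and acyclicity with 6 + j - v as
  -- depth.
  next : ℕ → ℕ
  next zero    = 3
  next (suc a) = suc (suc a)

  a<next : ∀ a → a < next a
  a<next zero    = s≤s z≤n
  a<next (suc a) = ≤-refl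

  Next : V → V → Set
  Next u v = toℕ v ≡ next (toℕ u)

  Linked : V → V → Set
  Linked u v = Next u v ⊎ Next v u

  linked? : ∀ u v → Dec (Linked u v)
  linked? u v = (toℕ v ℕ.≟ next (toℕ u)) ⊎-dec (toℕ u ℕ.≟ next (toℕ v))

  spider : Graph (7 + j)
  spider = record
    { adj        = λ u v → does (linked? u v)
    ; adj-sym    = λ u v → T-ext (does⁺ (linked? v u) ∘ Sum.swap ∘ does⁻ (linked? u v))
                                 (does⁺ (linked? u v) ∘ Sum.swap ∘ does⁻ (linked? v u))
    ; adj-irrefl = λ v → dec-false (linked? v v) λ
        { (inj₁ eq) → contradiction eq (ℕ.<⇒≢ (a<next (toℕ v)))
        ; (inj₂ eq) → contradiction eq (ℕ.<⇒≢ (a<next (toℕ v))) }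
    }

  linked⁻ : ∀ {u v} → Adj spider u v → Linked u v
  linked⁻ {u} {v} = does⁻ (linked? u v)

  linked⁺ : ∀ {u v} → Linked u v → Adj spider u v
  linked⁺ {u} {v} = does⁺ (linked? u v)

  spider-forest : IsForest spider
  spider-forest = IsForest-depth spider (λ v → 6 + j ∸ toℕ v) λ e e′ dv≤ dw≤ →
    toℕ-injective (trans (upper e dv≤) (sym (upper e′ dw≤)))
    where
    upper : ∀ {u v} → Adj spider u v → 6 + j ∸ toℕ v ≤ 6 + j ∸ toℕ u → Next u v
    upper {u} {v} e d≤ with linked⁻ {u} {v} e
    ... | inj₁ next-uv = next-uv
    ... | inj₂ next-vu = contradiction d≤ (<⇒≱ (ℕ.∸-monoʳ-< (subst (toℕ v <_) (sym next-vu) (a<next (toℕ v)))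
                                                     (ℕ.≤-pred (toℕ<n u))))

  climb : ∀ k (v : V) → 6 + j ≤ toℕ v + k → Star (Adj spider) v (fromℕ (6 + j))
  climb k v bound with toℕ v ℕ.≟ 6 + j
  ... | yes eq = subst (Star (Adj spider) v) (toℕ-injective (trans eq (sym (toℕ-fromℕ (6 + j))))) ε
  climb zero v bound | no ne = contradiction
    (ℕ.≤-antisym (ℕ.≤-pred (toℕ<n v)) (subst (6 + j ≤_) (+-identityʳ (toℕ v)) bound)) ne
  climb (suc k) v bound | no ne =
    linked⁺ {v} {w} (inj₁ w≡) ◅ climb k w (≤-trans bound (≤-trans (≤-reflexive (+-suc (toℕ v) k))
      (+-monoˡ-≤ k (subst (toℕ v <_) (sym w≡) (a<next (toℕ v))))))
    where
    next< : ∀ a → a < 6 + j → next a < 7 + j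
    next< zero    _  = s≤s (s≤s (s≤s (s≤s z≤n)))
    next< (suc a) a< = s≤s a<
    bounded = next< (toℕ v) (ℕ.≤∧≢⇒< (ℕ.≤-pred (toℕ<n v)) ne)
    w = fromℕ< bounded
    w≡ : toℕ w ≡ next (toℕ v)
    w≡ = toℕ-fromℕ< bounded

  spider-connected : Connected spider
  spider-connected = zero , λ u v → to-top u ◅◅ Star.reverse (λ {x} {y} → Adj-sym spider {x} {y}) (to-top v)
    where
    to-top : ∀ v → Star (Adj spider) v (fromℕ (6 + j))
    to-top v = climb (6 + j) v (ℕ.m≤n+m (6 + j) (toℕ v))

  below : ∀ {a b} → b ≡ next a → b ≢ 3 → b ≡ suc a
  below {zero}  eq b≢3 = contradiction eq b≢3
  below {suc a} eq _   = eq

  -- A vertex has at most one larger neighbour and, unless it is 3, at most one smaller one; so only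
  -- 3 can have three neighbours.
  centre : ∀ {v x y z} → Linked v x → Linked v y → Linked v z → x ≢ y → x ≢ z → y ≢ z → toℕ v ≡ 3
  centre {v} {x} {y} {z} vx vy vz x≢y x≢z y≢z with toℕ v ℕ.≟ 3
  ... | yes eq = eq
  ... | no v≢3 with vx | vy | vz
  ... | inj₁ p | inj₁ q | _      = contradiction (toℕ-injective (trans p (sym q))) x≢y
  ... | inj₁ p | inj₂ _ | inj₁ q = contradiction (toℕ-injective (trans p (sym q))) x≢z
  ... | inj₂ _ | inj₁ p | inj₁ q = contradiction (toℕ-injective (trans p (sym q))) y≢z
  ... | inj₂ p | inj₂ q | _      = contradiction (toℕ-injective (ℕ.suc-injective (trans (sym (below p v≢3)) (below q v≢3)))) x≢y
  ... | inj₂ p | inj₁ _ | inj₂ q = contradiction (toℕ-injective (ℕ.suc-injective (trans (sym (below p v≢3)) (below q v≢3)))) x≢z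
  ... | inj₁ _ | inj₂ p | inj₂ q = contradiction (toℕ-injective (ℕ.suc-injective (trans (sym (below p v≢3)) (below q v≢3)))) y≢z

  next≡ : ∀ {a b} → suc (suc a) ≡ next b → (b ≡ 0 × a ≡ 1) ⊎ b ≡ suc a
  next≡ {b = zero}  refl = inj₁ (refl , refl)
  next≡ {b = suc b} refl = inj₂ refl

  next≢1 : ∀ {b} → 1 ≢ next b
  next≢1 {zero} ()
  next≢1 {suc b} ()

  next≢0 : ∀ {b} → 0 ≢ next b
  next≢0 {zero} ()
  next≢0 {suc b} ()

  -- The centre 3 is fixed by its degree, then 0 as the only leaf next to it, then 2 and 1 because
  -- the long leg has at least three vertices. The rest of the path follows by induction.
  spider-asymmetric : Asymmetric spider
  spider-asymmetric σ v = toℕ-injective (trans (cong (toℕ ∘ f) (sym (Fin.fromℕ<-toℕ v (toℕ<n v)))) (fixed (toℕ v) (toℕ<n v)))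
    where
    f : V → V
    f = bij σ ⟨$⟩ʳ_

    f-injective : ∀ {u v} → f u ≡ f v → u ≡ v
    f-injective = Permutation-injective (bij σ)

    f-linked : ∀ {u v} → Linked u v → Linked (f u) (f v)
    f-linked {u} {v} l = linked⁻ {f u} {f v} (≅-adj σ (linked⁺ {u} {v} l))

    f-linked⁻ : ∀ {u} w → Linked (f u) w → ∃[ x ] f x ≡ w × Linked u x
    f-linked⁻ {u} w l = x , fx≡w , linked⁻ {u} {x} (subst T (preserves σ u x) (linked⁺ {f u} {f x} (subst (Linked (f u)) (sym fx≡w) l)))
      where
      x = bij σ ⟨$⟩ˡ w
      fx≡w : f x ≡ w
      fx≡w = inverseʳ (bij σ)

    f3 : f 3F ≡ 3F
    f3 = toℕ-injective (centre (f-linked {3F} {0F} (inj₂ refl)) (f-linked {3F} {2F} (inj₂ refl)) (f-linked {3F} {4F} (inj₁ refl))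
           (λ eq → case f-injective eq of λ ()) (λ eq → case f-injective eq of λ ()) (λ eq → case f-injective eq of λ ()))

    differ : ∀ {u v x} → f u ≡ x → toℕ (f v) ≡ toℕ x → u ≡ v
    differ fu fv = f-injective (trans fu (sym (toℕ-injective fv)))

    leaf0 : ∀ w → Linked (f 0F) w → w ≡ 3F
    leaf0 w l with f-linked⁻ {0F} w l
    ... | x , refl , inj₁ eq = trans (cong f (toℕ-injective eq)) f3
    ... | x , _ , inj₂ eq = contradiction eq (next≢0 {toℕ x})

    f0 : f 0F ≡ 0F
    f0 with subst (λ c → Linked c (f 0F)) f3 (f-linked {3F} {0F} (inj₂ refl))
    -- The image of 0 has 3 as its only neighbour. This excludes 4, which also has 5, and below it
    -- excludes 2, which also has 1.
    ... | inj₁ eq = case leaf0 5F (subst (λ c → Linked c 5F) (sym (toℕ-injective {j = 4F} eq)) (inj₁ refl)) of λ ()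
    ... | inj₂ eq with next≡ {1} {toℕ (f 0F)} eq
    ... | inj₁ (z , _) = toℕ-injective z
    ... | inj₂ two = case leaf0 1F (subst (λ c → Linked c 1F) (sym (toℕ-injective {j = 2F} two)) (inj₂ refl)) of λ ()

    f2 : f 2F ≡ 2F
    f2 with subst (λ c → Linked c (f 2F)) f3 (f-linked {3F} {2F} (inj₂ refl))
    ... | inj₂ eq with next≡ {1} {toℕ (f 2F)} eq
    ... | inj₁ (z , _) = case differ {0F} {2F} f0 z of λ ()
    ... | inj₂ two = toℕ-injective two
    -- If 2 went to 4, then 1 would go to 5, and 6 would be the image of a neighbour of 1. The only
    -- one is 2, which goes to 4.
    f2 | inj₁ four with f2≡4 ← toℕ-injective {i = f 2F} {j = 4F} four
      with subst (λ c → Linked c (f 1F)) f2≡4 (f-linked {2F} {1F} (inj₂ refl))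
    ... | inj₂ eq with next≡ {2} {toℕ (f 1F)} eq
    ... | inj₂ three = case differ {3F} {1F} f3 three of λ ()
    f2 | inj₁ four | inj₁ five
      with f-linked⁻ {1F} 6F (subst (λ c → Linked c 6F) (sym (toℕ-injective {i = f 1F} {j = 5F} five)) (inj₁ refl))
    ... | x , fx , inj₁ eq = case trans (sym (trans (cong f (toℕ-injective {i = x} {j = 2F} eq)) (toℕ-injective {j = 4F} four))) fx of λ ()
    ... | x , _ , inj₂ eq = contradiction eq (next≢1 {toℕ x})

    f1 : f 1F ≡ 1F
    f1 with subst (λ c → Linked c (f 1F)) f2 (f-linked {2F} {1F} (inj₂ refl))
    ... | inj₁ three = case differ {3F} {1F} f3 three of λ ()
    ... | inj₂ eq with next≡ {0} {toℕ (f 1F)} eq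
    ... | inj₂ one = toℕ-injective one

    Fixed : ℕ → Set
    Fixed a = ∀ (a< : a < 7 + j) → toℕ (f (fromℕ< a<)) ≡ a

    -- The image of 4 + a is a neighbour of 3 + a. The candidates other than 4 + a are 2 + a and,
    -- when a = 0, the vertex 0; both are already images of themselves.
    stretch : ∀ a → Fixed (2 + a) → Fixed (3 + a) → Fixed (4 + a)
    stretch a fix₂ fix₃ a< with subst (λ c → Linked c (f x)) fy≡y
                     (f-linked {y} {x} (inj₁ (trans (toℕ-fromℕ< a<) (cong next (sym (toℕ-fromℕ< p<))))))
      where
      p< : 3 + a < 7 + j
      p< = <⇒≤ a<
      x y : V
      x = fromℕ< a<
      y = fromℕ< p<
      fy≡y : f y ≡ y
      fy≡y = toℕ-injective (trans (fix₃ p<) (sym (toℕ-fromℕ< p<)))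
    ... | inj₁ eq = trans eq (cong next (toℕ-fromℕ< (<⇒≤ a<)))
    ... | inj₂ eq with next≡ {suc a} {toℕ (f (fromℕ< a<))} (trans (sym (toℕ-fromℕ< (<⇒≤ a<))) eq)
    ... | inj₁ (fx≡0 , _) =
      contradiction (trans (sym (toℕ-fromℕ< a<)) (cong toℕ (sym (differ {0F} {fromℕ< a<} f0 fx≡0)))) λ ()
    ... | inj₂ fx≡ = contradiction (f-injective {fromℕ< a<} {fromℕ< q<} (toℕ-injective (trans fx≡ (sym (fix₂ q<)))))
      λ x≡z → ℕ.m≢1+n+m (2 + a) {1} (trans (sym (toℕ-fromℕ< q<)) (trans (cong toℕ (sym x≡z)) (toℕ-fromℕ< a<)))
      where
      q< : 2 + a < 7 + j
      q< = <⇒≤ (<⇒≤ a<)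

    fixed : ∀ a → Fixed a
    fixed 0 _ = cong toℕ f0
    fixed 1 _ = cong toℕ f1
    fixed 2 _ = cong toℕ f2
    fixed 3 _ = cong toℕ f3
    fixed (suc (suc (suc (suc a)))) = stretch a (fixed (suc (suc a))) (fixed (suc (suc (suc a))))

  spiderTree : AsymTree (7 + j)
  spiderTree = record
    { graph = spider ; isTree = spider-connected , spider-forest ; asymmetric = spider-asymmetric }

asymTree-exists : 7 ≤ m → AsymTree m
asymTree-exists 7≤m with j , refl ← ℕ.m≤n⇒∃[o]m+o≡n 7≤m = Spider.spiderTree j

-- No asymmetric tree of order 2 to 6

-- Involutions as lists of disjoint transpositions.
matchings : ℕ → List (Fin n) → List (List (Fin n × Fin n))
matchings _       []       = [] ∷ []
matchings zero    (_ ∷ _)  = [] ∷ []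
matchings (suc k) (x ∷ xs) = matchings k xs ++ concatMap (λ (y , ys) → map ((x , y) ∷_) (matchings k ys)) (picks xs)
  where
  picks : List (Fin _) → List (Fin _ × List (Fin _))
  picks []       = []
  picks (y ∷ ys) = (y , ys) ∷ map (λ (z , zs) → z , y ∷ zs) (picks ys)

transpositions : List (Fin n × Fin n) → Permutation n n
transpositions []             = Perm.id
transpositions ((x , y) ∷ ps) = Perm.transpose x y Perm.∘ₚ transpositions ps

Symmetry : Graph n → Permutation n n → Set
Symmetry G π = (∀ u v → adj G (π ⟨$⟩ʳ u) (π ⟨$⟩ʳ v) ≡ adj G u v) × (∃[ v ] π ⟨$⟩ʳ v ≢ v)

-- A tree with a nontrivial automorphism has an involutory one, swapping isomorphic branches.
-- Searching involutions leaves 76 candidates on 6 vertices instead of 720 permutations.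
SymmetricCode : ∀ m → Code m → Set
SymmetricCode m c = Any (Symmetry (decode m c) ∘ transpositions) (matchings (suc m) (allFin (suc m)))

SymmetricCode? : ∀ m → Decidable (SymmetricCode m)
SymmetricCode? m c = Any.any? (λ ps → let π = transpositions ps ; G = decode m c in
  all? (λ u → all? λ v → adj G (π ⟨$⟩ʳ u) (π ⟨$⟩ʳ v) Bool.≟ adj G u v) ×-dec any? (λ v → ¬? ((π ⟨$⟩ʳ v) ≟ v)))
  (matchings (suc m) (allFin (suc m)))

allCodes? : ∀ m {P : Code m → Set} → Decidable P → Dec (∀ c → P c)
allCodes? zero    P? = map′ (λ p _ → p) (λ p → p tt) (P? tt)
allCodes? (suc m) P? = map′ (λ p (u , c) → p u c) (λ p u c → p (u , c))
  (all? λ u → allCodes? m λ c → P? (u , c))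

-- Decided by evaluation. `Code m` has m! elements and describes trees of order m + 1, so m from 1
-- to 5 covers the orders 2 to 6.
small-codes : ∀ m → 1 ≤ m → m ≤ 5 → ∀ c → SymmetricCode m c
small-codes 1 _ _ = toWitness {a? = allCodes? 1 (SymmetricCode? 1)} tt
small-codes 2 _ _ = toWitness {a? = allCodes? 2 (SymmetricCode? 2)} tt
small-codes 3 _ _ = toWitness {a? = allCodes? 3 (SymmetricCode? 3)} tt
small-codes 4 _ _ = toWitness {a? = allCodes? 4 (SymmetricCode? 4)} tt
small-codes 5 _ _ = toWitness {a? = allCodes? 5 (SymmetricCode? 5)} tt
small-codes (suc (suc (suc (suc (suc (suc m)))))) _ (s≤s (s≤s (s≤s (s≤s (s≤s ())))))

Asymmetric-≅ : {G : Graph m} {H : Graph n} → G ≅ H → Asymmetric G → Asymmetric H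
Asymmetric-≅ φ asym σ v = begin
  bij σ ⟨$⟩ʳ v                                  ≡⟨ inverseʳ (bij φ) ⟨
  π (π⁻¹ (bij σ ⟨$⟩ʳ v))                        ≡⟨ cong (π ∘ π⁻¹ ∘ (bij σ ⟨$⟩ʳ_)) (inverseʳ (bij φ)) ⟨
  π (π⁻¹ (bij σ ⟨$⟩ʳ π (π⁻¹ v)))                ≡⟨ cong π (asym (≅-trans (≅-trans φ σ) (≅-sym φ)) (π⁻¹ v)) ⟩
  π (π⁻¹ v)                                     ≡⟨ inverseʳ (bij φ) ⟩
  v                                             ∎
  where
  open ≡-Reasoning
  π   = bij φ ⟨$⟩ʳ_
  π⁻¹ = bij φ ⟨$⟩ˡ_

asymTree-order : AsymTree m → 1 < m → 7 ≤ m
asymTree-order {suc zero} _ (s≤s ())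
asymTree-order {suc (suc m)} S _ with suc m ℕ.≤? 5
... | no m≰5 = s≤s (≰⇒> m≰5)
... | yes m≤5 with encode (graph S) (isTree S)
... | c , φ with Any.satisfied (small-codes (suc m) (s≤s z≤n) m≤5 c)
... | ps , pres , v , moved = contradiction
  (Asymmetric-≅ φ (asymmetric S) (record { bij = transpositions ps ; preserves = pres }) v) moved

-- The closed formula: positions of the orders in the list

subst-≅ : (eq : m ≡ n) (S : AsymTree m) → graph (subst AsymTree eq S) ≅ graph S
subst-≅ refl S = ≅-refl

module Counting (Ω : TreeList) {a : ℕ → ℕ} (counts : CountsAsymTrees a) where

  open Extended Ω

  module _ (N : ℕ) where

    private
      module C = Bijection (counts (suc N))

    class : ∀ i → order⁺ i ≡ suc N → Fin (a (suc N))
    class i eq = C.to (subst AsymTree eq (tree⁺ i))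

    class-injective : ∀ i j p q → class i p ≡ class j q → i ≡ j
    class-injective i j p q eq = distinct⁺ i j
      (≅-trans (≅-sym (subst-≅ p (tree⁺ i))) (≅-trans (C.injective eq) (subst-≅ q (tree⁺ j))))

    preimage : Fin (a (suc N)) → AsymTree (suc N)
    preimage c = proj₁ (C.surjective c)

    to-preimage : ∀ c → C.to (preimage c) ≡ c
    to-preimage c = proj₂ (C.surjective c) {preimage c} ≅-refl

    representative : Fin (a (suc N)) → ℕ
    representative c = proj₁ (complete⁺ (preimage c))

    representative-order : ∀ c → order⁺ (representative c) ≡ suc N
    representative-order c = sym (↔⇒≡ (bij (proj₂ (complete⁺ (preimage c)))))

    representative-injective : ∀ c d → representative c ≡ representative d → c ≡ d
    representative-injective c d eq =
      trans (sym (to-preimage c)) (trans (C.cong {preimage c} {preimage d} iso) (to-preimage d))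
      where
      iso = ≅-trans (proj₂ (complete⁺ (preimage c)))
              (subst (λ i → graph (tree⁺ i) ≅ graph (preimage d)) (sym eq) (≅-sym (proj₂ (complete⁺ (preimage d)))))

  -- Since the list is sorted, the trees of order at most N should fill its first a 1 + ... + a N
  -- places. The induction on N uses the pigeonhole principle once in each direction.
  order≤⇔index< : ∀ N j → (order⁺ j ≤ N → j < ∑₁ N a) × (j < ∑₁ N a → order⁺ j ≤ N)
  order≤⇔index< zero    j = (λ o≤0 → contradiction (≤-trans (order⁺-positive j) o≤0) λ ()) , λ ()
  order≤⇔index< (suc N) j = to , from
    where
    Σa = ∑₁ N a
    c = a (suc N)

    exact : ∀ {i} → Σa ≤ i → order⁺ i ≤ suc N → order⁺ i ≡ suc N
    exact {i} Σa≤i o≤ = ℕ.≤-antisym o≤ (≰⇒> λ o≤N → <⇒≱ (proj₁ (order≤⇔index< N i) o≤N) Σa≤i)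

    to : order⁺ j ≤ suc N → j < Σa + c
    -- Otherwise the c + 1 places from Σa to Σa + c would all hold trees of order N + 1, of which
    -- there are only c classes.
    to oj≤ = ≰⇒> λ Σa+c≤j →
      let small : (x : Fin (suc c)) → order⁺ (Σa + toℕ x) ≡ suc N
          small x = exact (ℕ.m≤m+n Σa _)
            (≤-trans (monotone⁺ (≤-trans (+-monoʳ-≤ Σa (ℕ.≤-pred (toℕ<n x))) Σa+c≤j)) oj≤)
      in Fin.<⇒notInjective {f = λ x → class N (Σa + toℕ x) (small x)} (ℕ.n<1+n c)
           λ {x} {y} eq → toℕ-injective (ℕ.+-cancelˡ-≡ Σa (toℕ x) (toℕ y)
             (class-injective N (Σa + toℕ x) (Σa + toℕ y) (small x) (small y) eq))

    from : j < Σa + c → order⁺ j ≤ suc N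
    from j<Σa+c with j ℕ.<? Σa
    ... | yes j<Σa = ≤-trans (proj₂ (order≤⇔index< N j) j<Σa) (ℕ.n≤1+n N)
    -- Otherwise representatives of all c classes of order N + 1 would have to sit in the fewer than
    -- c places from Σa up to j.
    ... | no j≮Σa = ≮⇒≥ λ N<oj →
      let rep = representative N
          below-j : ∀ x → rep x < j
          below-j x = ≰⇒> λ j≤ → <⇒≱ N<oj (≤-trans (monotone⁺ j≤) (≤-reflexive (representative-order N x)))
          above : ∀ x → Σa ≤ rep x
          above x = ≮⇒≥ λ r<Σa → <⇒≱ (s≤s (proj₂ (order≤⇔index< N (rep x)) r<Σa))
                                       (≤-reflexive (sym (representative-order N x)))
          offset : ∀ x → rep x ∸ Σa < j ∸ Σa
          offset x = ℕ.∸-monoˡ-< (below-j x) (above x)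
      in Fin.<⇒notInjective {f = λ x → fromℕ< (offset x)}
           (ℕ.+-cancelˡ-< Σa _ _ (subst (_< Σa + c) (sym (ℕ.m+[n∸m]≡n (≮⇒≥ j≮Σa))) j<Σa+c))
           λ {x} {y} eq → representative-injective N x y (ℕ.∸-cancelʳ-≡ (above x) (above y)
             (trans (sym (toℕ-fromℕ< (offset x))) (trans (cong toℕ eq) (toℕ-fromℕ< (offset y)))))

  order⁺-block : ∀ N w → w < a (suc N) → order⁺ (∑₁ N a + w) ≡ suc N
  order⁺-block N w w< = ℕ.≤-antisym
    (proj₂ (order≤⇔index< (suc N) _) (ℕ.+-monoʳ-< (∑₁ N a) w<))
    (≰⇒> λ o≤N → <⇒≱ (proj₁ (order≤⇔index< N _) o≤N) (ℕ.m≤m+n _ w))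

  sum<-block : ∀ N w → w ≤ a (suc N) → sum< order⁺ (∑₁ N a + w) ≡ sum< order⁺ (∑₁ N a) + w * suc N
  sum<-block N zero    _  = trans (cong (sum< order⁺) (+-identityʳ (∑₁ N a))) (sym (+-identityʳ _))
  sum<-block N (suc w) w< = begin
    sum< order⁺ (Σa + suc w)                              ≡⟨ cong (sum< order⁺) (+-suc Σa w) ⟩
    sum< order⁺ (Σa + w) + order⁺ (Σa + w)                 ≡⟨ cong₂ _+_ (sum<-block N w (<⇒≤ w<)) (order⁺-block N w w<) ⟩
    sum< order⁺ Σa + w * suc N + suc N                    ≡⟨ +-assoc (sum< order⁺ Σa) (w * suc N) (suc N) ⟩
    sum< order⁺ Σa + (w * suc N + suc N)                  ≡⟨ cong (_+_ (sum< order⁺ Σa)) (+-comm (w * suc N) (suc N)) ⟩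
    sum< order⁺ Σa + suc w * suc N                        ∎
    where
    open ≡-Reasoning
    Σa = ∑₁ N a

  sum<-∑₁ : ∀ N → sum< order⁺ (∑₁ N a) ≡ ∑₁ N (λ i → i * a i)
  sum<-∑₁ zero    = refl
  sum<-∑₁ (suc N) = trans (sum<-block N (a (suc N)) ≤-refl)
    (cong₂ _+_ (sum<-∑₁ N) (ℕ.*-comm (a (suc N)) (suc N)))

  -- By `w-bound` the next tree in the list has order N + 1, and r < N + 1 says that it no longer
  -- fits.
  Expansion-Maximal : ∀ {n N w r} → Expansion a n N w r → Maximal n (∑₁ N a + w)
  Expansion-Maximal {n} {N} {w} {r} exp =
    (begin
      sum< order⁺ (∑₁ N a + w)                 ≡⟨ total ⟩
      ∑₁ N (λ i → i * a i) + w * suc N         ≤⟨ ℕ.m≤m+n _ r ⟩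
      ∑₁ N (λ i → i * a i) + w * suc N + r     ≡⟨ split ⟨
      n                                        ∎) ,
    (begin-strict
      n                                                       ≡⟨ split ⟩
      ∑₁ N (λ i → i * a i) + w * suc N + r                    <⟨ ℕ.+-monoʳ-< _ r-bound ⟩
      ∑₁ N (λ i → i * a i) + w * suc N + suc N                ≡⟨ cong₂ _+_ total (order⁺-block N w w-bound) ⟨
      sum< order⁺ (∑₁ N a + w) + order⁺ (∑₁ N a + w)          ∎)
    where
    open Expansion exp
    open ℕ.≤-Reasoning
    total = trans (sum<-block N w (<⇒≤ w-bound)) (cong (_+ w * suc N) (sum<-∑₁ N))

  n≤∑₁ : ∀ n → 1 ≤ a n → n ≤ ∑₁ n (λ i → i * a i)
  n≤∑₁ zero    _  = z≤n
  n≤∑₁ (suc n) 1≤ = ≤-trans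
    (≤-trans (≤-reflexive (sym (ℕ.*-identityʳ (suc n)))) (ℕ.*-monoʳ-≤ (suc n) 1≤))
    (ℕ.m≤n+m (suc n * a (suc n)) (∑₁ n (λ i → i * a i)))

  inhabited : ∀ {i} → 7 ≤ i → 1 ≤ a i
  inhabited {i} 7≤i = ≤-trans (s≤s z≤n) (toℕ<n (Bijection.to (counts i) (asymTree-exists 7≤i)))

  ∑₁-unbounded : ∀ n → ∃[ N ] n < ∑₁ N (λ i → i * a i)
  -- An asymmetric tree of order 7 + n exists, so the last summand alone exceeds n.
  ∑₁-unbounded n = 7 + n ,
    ≤-trans (ℕ.m≤n+m (suc n) 6) (n≤∑₁ (7 + n) (inhabited (ℕ.m≤m+n 7 n)))

  -- N + 1 is the least length at which the sum exceeds n; w and r are quotient and remainder of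
  -- what is left on division by N + 1.
  expansion-below : ∀ n k → n < ∑₁ k (λ i → i * a i) → ∃[ N ] ∃[ w ] ∃[ r ] Expansion a n N w r
  expansion-below n k n<k with least (λ N → n ℕ.<? ∑₁ N (λ i → i * a i)) k n<k
  ... | suc N , n< , first = N , d / suc N , d % suc N , record
    { lower   = lower
    ; upper   = n<
    ; split   = trans n≡ (trans (cong (_+_ S) (trans (m≡m%n+[m/n]*n d (suc N)) (+-comm (d % suc N) _))) (sym (+-assoc S _ _)))
    ; w-bound = ℕ.*-cancelʳ-< (suc N) _ _ (≤-<-trans (m/n*n≤m d (suc N))
                  (ℕ.+-cancelˡ-< S _ _ (≤-trans (≤-reflexive (cong suc (sym n≡)))
                    (≤-trans n< (≤-reflexive (cong (_+_ S) (ℕ.*-comm (suc N) (a (suc N)))))))))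
    ; r-bound = m%n<n d (suc N)
    }
    where
    S = ∑₁ N (λ i → i * a i)
    d = n ∸ S
    lower : S ≤ n
    lower = ≮⇒≥ (first N ≤-refl)
    n≡ : n ≡ S + d
    n≡ = sym (ℕ.m+[n∸m]≡n lower)

  expansion : ∀ n → ∃[ N ] ∃[ w ] ∃[ r ] Expansion a n N w r
  expansion n = uncurry (expansion-below n) (∑₁-unbounded n)

  formula : ∀ {n k} → Maximal n k → k ≤ n → ∀ {N w r} → Expansion a n N w r → + (n ∸ k) ≡ + n - + (∑₁ N a) - + w
  formula {n} {k} max k≤n {N} {w} exp = begin
    + (n ∸ k)                     ≡⟨ cong (λ x → + (n ∸ x)) k≡ ⟩
    + (n ∸ (Σa + w))               ≡⟨ cong +_ (ℕ.∸-+-assoc n Σa w) ⟨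
    + (n ∸ Σa ∸ w)                 ≡⟨ pos-∸ (n ∸ Σa) w (ℕ.m+n≤o⇒m≤o∸n w (subst (_≤ n) (+-comm Σa w) Σa+w≤n)) ⟩
    + (n ∸ Σa) - + w               ≡⟨ cong (_- + w) (pos-∸ n Σa (≤-trans (ℕ.m≤m+n Σa w) Σa+w≤n)) ⟩
    + n - + Σa - + w               ∎
    where
    open ≡-Reasoning
    Σa = ∑₁ N a
    max′ = Expansion-Maximal exp
    k≡ : k ≡ Σa + w
    k≡ = ℕ.≤-antisym (Maximal-greatest max′ (proj₁ max)) (Maximal-greatest max (proj₁ max′))
    Σa+w≤n : Σa + w ≤ n
    Σa+w≤n = subst (_≤ n) k≡ k≤n
    pos-∸ : ∀ x y → y ≤ x → + (x ∸ y) ≡ + x - + y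
    pos-∸ x y y≤x = trans (sym (ℤ.⊖-≥ y≤x)) (sym (ℤ.m-n≡m⊖n x y))

-- Sizes of finite subsets

elements : Subset n → List (Fin n)
elements []            = []
elements (inside  ∷ s) = zero ∷ map suc (elements s)
elements (outside ∷ s) = map suc (elements s)

length-elements : (s : Subset n) → length (elements s) ≡ ∣ s ∣
length-elements []            = refl
length-elements (inside  ∷ s) = cong suc (trans (length-map suc (elements s)) (length-elements s))
length-elements (outside ∷ s) = trans (length-map suc (elements s)) (length-elements s)

∈-elements⁺ : {s : Subset n} → ∀ {x} → x Subset.∈ s → x ∈ elements s
∈-elements⁺ {s = inside  ∷ s} here       = here refl
∈-elements⁺ {s = inside  ∷ s} (there x∈) = there (∈-map⁺ suc (∈-elements⁺ x∈))
∈-elements⁺ {s = outside ∷ s} (there x∈) = ∈-map⁺ suc (∈-elements⁺ x∈)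

∈-elements⁻ : (s : Subset n) → ∀ {x} → x ∈ elements s → x Subset.∈ s
∈-elements⁻ (inside  ∷ s) (here refl) = here
∈-elements⁻ (inside  ∷ s) (there x∈) with ∈-map⁻ suc x∈
... | y , y∈ , refl = there (∈-elements⁻ s y∈)
∈-elements⁻ (outside ∷ s) x∈ with ∈-map⁻ suc x∈
... | y , y∈ , refl = there (∈-elements⁻ s y∈)

elements-unique : (s : Subset n) → Unique (elements s)
elements-unique []            = []
elements-unique (inside  ∷ s) =
  All.tabulate (λ x∈ 0≡x → case ∈-map⁻ suc x∈ of λ { (y , _ , refl) → case 0≡x of λ () })
  ∷ Unique.map⁺ Fin.suc-injective (elements-unique s)
elements-unique (outside ∷ s) = Unique.map⁺ Fin.suc-injective (elements-unique s)

∣image∣ : {f : Fin m → Fin n} → Injective _≡_ _≡_ f → (s : Subset n) →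
          (∀ i → f i Subset.∈ s) → (∀ {x} → x Subset.∈ s → ∃[ i ] f i ≡ x) → ∣ s ∣ ≡ m
∣image∣ {m} {f = f} inj s f∈ covers = trans (sym (length-elements s)) (trans
  (ℕ.≤-antisym
    (length-mono-⊆ (elements-unique s) λ x∈ → case covers (∈-elements⁻ s x∈) of λ { (i , refl) → ∈-map⁺ f (∈-allFin i) })
    (length-mono-⊆ (Unique.map⁺ inj (Unique.allFin⁺ m)) λ x∈ → case ∈-map⁻ f x∈ of λ { (i , _ , refl) → ∈-elements⁺ (f∈ i) }))
  (trans (length-map f (allFin m)) (length-tabulate {n = m} id)))

enumerate : (s : Subset n) → m ≤ ∣ s ∣ → Fin m → Fin n
enumerate s m≤ i = lookup (elements s) (Fin.inject≤ i (≤-trans m≤ (≤-reflexive (sym (length-elements s)))))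

enumerate-injective : (s : Subset n) (m≤ : m ≤ ∣ s ∣) → Injective _≡_ _≡_ (enumerate s m≤)
enumerate-injective s m≤ eq = Fin.inject≤-injective _ _ _ _ (lookup-injective (elements-unique s) _ _ eq)

enumerate-∈ : (s : Subset n) (m≤ : m ≤ ∣ s ∣) → ∀ i → enumerate s m≤ i Subset.∈ s
enumerate-∈ s m≤ i = ∈-elements⁻ s (∈-lookup {xs = elements s} _)

∣─∣ : (s t : Subset n) → t ⊆ s → ∣ s ─ t ∣ + ∣ t ∣ ≡ ∣ s ∣
∣─∣ []            []            _   = refl
∣─∣ (inside  ∷ s) (inside  ∷ t) t⊆s = trans (+-suc _ _) (cong suc (∣─∣ s t (Subset.drop-∷-⊆ t⊆s)))
∣─∣ (inside  ∷ s) (outside ∷ t) t⊆s = cong suc (∣─∣ s t (Subset.drop-∷-⊆ t⊆s))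
∣─∣ (outside ∷ s) (inside  ∷ t) t⊆s = case t⊆s here of λ ()
∣─∣ (outside ∷ s) (outside ∷ t) t⊆s = ∣─∣ s t (Subset.drop-∷-⊆ t⊆s)

∈─⇒∉ : (s t : Subset n) → ∀ {x} → x Subset.∈ s ─ t → x Subset.∉ t
∈─⇒∉ (_ ∷ s) (_ ∷ t) (there x∈) (there x∈t) = ∈─⇒∉ s t x∈ x∈t

─-∪ : (s t : Subset n) → t ⊆ s → (s ─ t) ∪ t ≡ s
─-∪ s t t⊆s = Subset.⊆-antisym
  (λ x∈ → [ Subset.p─q⊆p s t , t⊆s ]′ (Subset.x∈p∪q⁻ (s ─ t) t x∈))
  (λ {x} x∈s → case x Subset.∈? t of λ
    { (yes x∈t) → Subset.x∈p∪q⁺ {p = s ─ t} {q = t} (inj₂ x∈t)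
    ; (no x∉t) → Subset.x∈p∪q⁺ {p = s ─ t} {q = t} (inj₁ (Subset.x∈p∧x∉q⇒x∈p─q x∈s x∉t)) })

∣s∣≡0⇒∉ : (s : Subset n) → ∣ s ∣ ≡ 0 → ∀ {x} → x Subset.∉ s
∣s∣≡0⇒∉ s eq x∈ = case elements-nonempty of λ ()
  where
  elements-nonempty : 1 ≤ 0
  elements-nonempty = subst (1 ≤_) (trans (length-elements s) eq) (length-pos (∈-elements⁺ x∈))
    where
    length-pos : ∀ {x} {xs : List (Fin _)} → x ∈ xs → 1 ≤ length xs
    length-pos (here _)  = s≤s z≤n
    length-pos (there _) = s≤s z≤n

AllPairs-lookup : {R : A → A → Set} {xs : List A} → AllPairs R xs →
                  ∀ {x y} → x ∈ xs → y ∈ xs → x ≡ y ⊎ R x y ⊎ R y x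
AllPairs-lookup (_ ∷ _)   (here refl) (here refl) = inj₁ refl
AllPairs-lookup (rx ∷ _)  (here refl) (there y∈)  = inj₂ (inj₁ (All.lookup rx y∈))
AllPairs-lookup (ry ∷ _)  (there x∈)  (here refl) = inj₂ (inj₂ (All.lookup ry x∈))
AllPairs-lookup (_ ∷ rxs) (there x∈)  (there y∈)  = AllPairs-lookup rxs x∈ y∈

-- Invariants and existence of runs of the procedure

module Execution (Ω : TreeList) (n : ℕ) where

  open TreeList Ω
  open Extended Ω
  open Procedure Ω n

  ∈-vertices⁺ : ∀ p x → at p x Subset.∈ vertices p
  ∈-vertices⁺ p x = Vec.lookup⇒[]= (at p x) (vertices p)
    (trans (Vec.lookup∘tabulate _ (at p x)) (dec-true (any? λ y → at p y ≟ at p x) (x , refl)))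

  ∈-vertices⁻ : ∀ p {v} → v Subset.∈ vertices p → ∃[ x ] at p x ≡ v
  ∈-vertices⁻ p {v} v∈ = does⁻ (any? λ x → at p x ≟ v)
    (subst T (trans (sym (Vec.[]=⇒lookup v∈)) (Vec.lookup∘tabulate _ v)) tt)

  ∣vertices∣ : ∀ p → ∣ vertices p ∣ ≡ order (index p)
  ∣vertices∣ p = ∣image∣ (injective p) (vertices p) (∈-vertices⁺ p) (∈-vertices⁻ p)

  DisjointCopies : Copy → Copy → Set
  DisjointCopies p q = ∀ x y → at p x ≢ at q y

  record Layout (s : State) : Set where
    field
      disjoint  : AllPairs DisjointCopies (copies s)
      placed    : ∀ {p} → p ∈ copies s → ∀ x → at p x Subset.∉ available s
      avoids    : ∀ {p} → p ∈ copies s → ∀ x → at p x ≢ removed s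
      unremoved : removed s Subset.∉ available s
      covers    : ∀ v → v ≡ removed s ⊎ v Subset.∈ available s ⊎ (∃[ p ] p ∈ copies s × ∃[ x ] at p x ≡ v)

  Layout-add : ∀ {v S ps} → Layout ⟨ v , S , ps ⟩ → ∀ q → vertices q ⊆ S → Layout ⟨ v , S ─ vertices q , q ∷ ps ⟩
  Layout-add {v} {S} {ps} L q q⊆S = record
    { disjoint  = All.tabulate (λ p∈ x y qx≡py → placed p∈ y (subst (Subset._∈ S) qx≡py (q⊆S (∈-vertices⁺ q x)))) ∷ disjoint
    ; placed    = λ { (here refl) x x∈ → ∈─⇒∉ S (vertices q) x∈ (∈-vertices⁺ q x)
                    ; (there p∈) x x∈ → placed p∈ x (Subset.p─q⊆p S (vertices q) x∈) }
    ; avoids    = λ { (here refl) x eq → unremoved (subst (Subset._∈ S) eq (q⊆S (∈-vertices⁺ q x)))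
                    ; (there p∈) → avoids p∈ }
    ; unremoved = unremoved ∘ Subset.p─q⊆p S (vertices q)
    ; covers    = cover
    }
    where
    open Layout L
    cover : ∀ u → u ≡ v ⊎ u Subset.∈ S ─ vertices q ⊎ (∃[ p ] p ∈ q ∷ ps × ∃[ x ] at p x ≡ u)
    cover u with covers u
    ... | inj₁ eq = inj₁ eq
    ... | inj₂ (inj₂ (p , p∈ , x , eq)) = inj₂ (inj₂ (p , there p∈ , x , eq))
    ... | inj₂ (inj₁ u∈S) with u Subset.∈? vertices q
    ... | yes u∈q = let x , eq = ∈-vertices⁻ q u∈q in inj₂ (inj₂ (q , here refl , x , eq))
    ... | no u∉q  = inj₂ (inj₁ (Subset.x∈p∧x∉q⇒x∈p─q u∈S u∉q))

  record Invariant (s : State) : Set where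
    field
      layout  : Layout s
      indices : map index (copies s) ≡ downFrom (length (copies s))
      room    : ∣ available s ∣ + sum< order⁺ (suc (length (copies s))) ≡ n

    firstUnused : FirstUnused s (length (copies s))
    firstUnused = subst (length (copies s) ∉_) (sym indices) (λ k∈ → ℕ.<-irrefl refl (∈-downFrom⁻ k∈)) ,
                  λ j j<k → subst (j ∈_) (sym indices) (∈-downFrom⁺ j<k)

    firstUnused-unique : ∀ {i} → FirstUnused s i → i ≡ length (copies s)
    firstUnused-unique {i} (i∉ , below) = ℕ.≤-antisym
      (≮⇒≥ λ k<i → proj₁ firstUnused (below _ k<i))
      (≮⇒≥ λ i<k → i∉ (proj₂ firstUnused i i<k))

  invariant-initial : ∀ v → Invariant ⟨ v , Subset.⊤ Subset.- v , [] ⟩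
  invariant-initial v = record
    { layout  = record
      { disjoint  = []
      ; placed    = λ ()
      ; avoids    = λ ()
      ; unremoved = λ v∈ → ∈─⇒∉ Subset.⊤ ⁅ v ⁆ v∈ (Subset.x∈⁅x⁆ v)
      ; covers    = cover
      }
    ; indices = refl
    ; room    = trans (cong (_+_ ∣ Subset.⊤ Subset.- v ∣) (sym (Subset.∣⁅x⁆∣≡1 v)))
                  (trans (∣─∣ Subset.⊤ ⁅ v ⁆ (λ _ → Subset.∈⊤)) (Subset.∣⊤∣≡n n))
    }
    where
    cover : ∀ u → u ≡ v ⊎ u Subset.∈ Subset.⊤ Subset.- v ⊎ _
    cover u with u ≟ v
    ... | yes eq = inj₁ eq
    ... | no ne  = inj₂ (inj₁ (Subset.x∈p∧x≢y⇒x∈p-y Subset.∈⊤ ne))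

  invariant-step : ∀ {s} → Invariant s → ∀ p → FirstUnused s (index p) → vertices p ⊆ available s →
                   Invariant ⟨ removed s , available s ─ vertices p , p ∷ copies s ⟩
  invariant-step {s} I p first p⊆ = record
    { layout  = Layout-add layout p p⊆
    ; indices = cong₂ _∷_ index≡ indices
    ; room    = begin
        ∣ S′ ∣ + (Σ + order k)                      ≡⟨ cong (λ i → ∣ S′ ∣ + (Σ + order i)) index≡ ⟨
        ∣ S′ ∣ + (Σ + order (index p))              ≡⟨ cong (_+_ ∣ S′ ∣) (+-comm Σ _) ⟩
        ∣ S′ ∣ + (order (index p) + Σ)              ≡⟨ +-assoc ∣ S′ ∣ _ Σ ⟨
        ∣ S′ ∣ + order (index p) + Σ                ≡⟨ cong (λ i → ∣ S′ ∣ + i + Σ) (∣vertices∣ p) ⟨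
        ∣ S′ ∣ + ∣ vertices p ∣ + Σ                 ≡⟨ cong (_+ Σ) (∣─∣ (available s) (vertices p) p⊆) ⟩
        ∣ available s ∣ + Σ                         ≡⟨ room ⟩
        n                                           ∎
    }
    where
    open Invariant I
    open ≡-Reasoning
    k  = length (copies s)
    Σ  = sum< order⁺ (suc k)
    S′ = available s ─ vertices p
    index≡ : index p ≡ k
    index≡ = firstUnused-unique first

  mutual
    invariant₂ : ∀ {s} → AtStep₂ s → Invariant s
    invariant₂ (step₁ v)  = invariant-initial v
    invariant₂ (loop r _) = invariant₃ r

    invariant₃ : ∀ {s} → AtStep₃ s → Invariant s
    invariant₃ (step₂ r p first p⊆) = invariant-step (invariant₂ r) p first p⊆

  invariant-maximal : ∀ {s} → Invariant s → ¬ Continue s → Maximal n (suc (length (copies s)))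
  invariant-maximal {s} I stop =
    ≤-trans (ℕ.m≤n+m Σ ∣ available s ∣) (≤-reflexive room) ,
    ≤-trans (≤-reflexive (cong suc (trans (sym room) (+-comm ∣ available s ∣ Σ))))
      (ℕ.+-monoʳ-< Σ (≰⇒> λ fits → stop (_ , firstUnused , fits)))
    where
    open Invariant I
    Σ = sum< order⁺ (suc (length (copies s)))

  -- What holds at Step 4. Replacement can break the pattern of indices in `Invariant`; the indices
  -- remain distinct, and `maximal` depends only on the number of copies, which is kept.
  record Packing (s : State) : Set where
    field
      layout          : Layout s
      full            : ∣ available s ∣ ≡ 0
      distinctIndices : AllPairs (λ p q → index p ≢ index q) (copies s)
      maximal         : Maximal n (suc (length (copies s)))

  invariant-distinct : ∀ {s} → Invariant s → AllPairs (λ p q → index p ≢ index q) (copies s)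
  invariant-distinct {s} I = AllPairsP.map⁻ (subst Unique (sym indices) (Unique.downFrom⁺ _))
    where open Invariant I

  packing : ∀ {s} → AtStep₄ s → Packing s
  packing (finish r stop full) = record
    { layout          = Invariant.layout (invariant₃ r)
    ; full            = full
    ; distinctIndices = invariant-distinct (invariant₃ r)
    ; maximal         = invariant-maximal (invariant₃ r) stop
    }
  -- Matching on the last Step 2 recovers the state before p was placed. Its available set is S, so
  -- the replacement amounts to placing q there instead of p.
  packing (replace r@(step₂ {s} r₂ p first p⊆) stop nonempty q size q⊆) = record
    { layout          = Layout-add (subst (λ S → Layout ⟨ removed s , S , copies s ⟩) (sym S≡) layout) q q⊆
    ; full            = ℕ.+-cancelʳ-≡ (order (index q)) _ 0 (begin
        ∣ S ─ vertices q ∣ + order (index q)         ≡⟨ cong (_+_ ∣ S ─ vertices q ∣) (∣vertices∣ q) ⟨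
        ∣ S ─ vertices q ∣ + ∣ vertices q ∣          ≡⟨ ∣─∣ S (vertices q) q⊆ ⟩
        ∣ S ∣                                        ≡⟨ size ⟨
        order (index q)                              ∎)
    ; distinctIndices = AllP.map⁻ (All.tabulate fresh) ∷ invariant-distinct (invariant₂ r₂)
    ; maximal         = invariant-maximal (invariant₃ r) stop
    }
    where
    open Invariant (invariant₂ r₂)
    open ≡-Reasoning
    S = (available s ─ vertices p) ∪ vertices p

    S≡ : S ≡ available s
    S≡ = ─-∪ (available s) (vertices p) p⊆

    bigger : order (index p) < order (index q)
    bigger = ℕ.≤-trans (+-monoˡ-≤ (order (index p)) (ℕ.n≢0⇒n>0 nonempty)) (≤-reflexive
      (trans (cong (_+_ ∣ available s ─ vertices p ∣) (sym (∣vertices∣ p)))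
        (trans (∣─∣ (available s) (vertices p) p⊆) (trans (cong ∣_∣ (sym S≡)) (sym size)))))

    -- T* is larger than the deleted tree, hence than every tree placed earlier, because Ω is
    -- sorted.
    fresh : ∀ {i} → i ∈ map index (copies s) → index q ≢ i
    fresh {i} i∈ refl = <⇒≱ bigger (monotone⁺ {suc i} {suc (index p)} (s≤s (<⇒≤
      (subst (i <_) (sym (firstUnused-unique first)) (∈-downFrom⁻ (subst (i ∈_) indices i∈))))))

  copyOf : ∀ i (S : Subset n) → order i ≤ ∣ S ∣ → Copy
  copyOf i S fits = record { index = i ; at = enumerate S fits ; injective = enumerate-injective S fits }

  copyOf-⊆ : ∀ i S fits → vertices (copyOf i S fits) ⊆ S
  copyOf-⊆ i S fits v∈ with ∈-vertices⁻ (copyOf i S fits) v∈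
  ... | x , refl = enumerate-∈ S fits x

  order-≥7 : ∀ i → 7 ≤ order i
  order-≥7 i = asymTree-order (tree i) (nontrivial i)

  module _ {s : State} (r : AtStep₂ s) (fits : order (length (copies s)) ≤ ∣ available s ∣) where

    private
      k  = length (copies s)
      p  = copyOf k (available s) fits
      p⊆ = copyOf-⊆ k (available s) fits
      S′ = available s ─ vertices p

    after : State
    after = ⟨ removed s , S′ , p ∷ copies s ⟩

    next₃ : AtStep₃ after
    next₃ = step₂ r p (Invariant.firstUnused (invariant₂ r)) p⊆

    stop : ¬ order (suc k) ≤ ∣ S′ ∣ → ¬ Continue after
    stop ¬fits (i , first , i≤) =
      ¬fits (subst (λ i → order i ≤ ∣ S′ ∣) (Invariant.firstUnused-unique (invariant₃ next₃) first) i≤)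

    shrinks : ∣ S′ ∣ < ∣ available s ∣
    shrinks = begin
      1 + ∣ S′ ∣                      ≡⟨ +-comm 1 ∣ S′ ∣ ⟩
      ∣ S′ ∣ + 1                      ≤⟨ +-monoʳ-≤ ∣ S′ ∣ (<⇒≤ (nontrivial k)) ⟩
      ∣ S′ ∣ + order k                ≡⟨ cong (_+_ ∣ S′ ∣) (∣vertices∣ p) ⟨
      ∣ S′ ∣ + ∣ vertices p ∣         ≡⟨ ∣─∣ (available s) (vertices p) p⊆ ⟩
      ∣ available s ∣                 ∎
      where open ℕ.≤-Reasoning

    complete-run : ¬ order (suc k) ≤ ∣ S′ ∣ → Run
    complete-run ¬fits with ∣ S′ ∣ ℕ.≟ 0
    ... | yes full = record { reached = finish next₃ (stop ¬fits) full }
    ... | no nonempty = record { reached = replace next₃ (stop ¬fits) nonempty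
                                   (copyOf i S (≤-reflexive (sym size))) (sym size) (copyOf-⊆ i S (≤-reflexive (sym size))) }
      where
      S = S′ ∪ vertices p
      -- S has room for the deleted tree, whose order is at least 7; hence a spider on exactly S
      -- exists and Ω contains a copy.
      7≤∣S∣ : 7 ≤ ∣ S ∣
      7≤∣S∣ = ≤-trans (order-≥7 k) (≤-trans fits (≤-reflexive (cong ∣_∣ (sym (─-∪ (available s) (vertices p) p⊆)))))
      found = complete (asymTree-exists 7≤∣S∣) (≤-trans (s≤s (s≤s z≤n)) 7≤∣S∣)
      i = proj₁ found
      size : ∣ S ∣ ≡ order i
      size = ↔⇒≡ (bij (proj₂ found))

  run-from : ∀ fuel {s} → AtStep₂ s → order (length (copies s)) ≤ ∣ available s ∣ → ∣ available s ∣ ≤ fuel → Run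
  run-from zero r fits bound = contradiction (≤-trans (nontrivial _) (≤-trans fits bound)) λ ()
  run-from (suc fuel) {s} r fits bound with order (suc (length (copies s))) ℕ.≤? ∣ available (after r fits) ∣
  ... | yes fits′ = run-from fuel
    (loop (next₃ r fits) (_ , Invariant.firstUnused (invariant₃ (next₃ r fits)) , fits′)) fits′
    (ℕ.≤-pred (≤-trans (shrinks r fits) bound))
  ... | no ¬fits′ = complete-run r fits ¬fits′

  -- The spider of order 7 occurs somewhere in the sorted list. This makes n ≥ 8 suffice: Step 1
  -- leaves at least 7 vertices.
  order0≤7 : order 0 ≤ 7
  order0≤7 with complete (asymTree-exists ≤-refl) (s≤s (s≤s z≤n))
  ... | i , φ = ≤-trans (monotone⁺ {1} {suc i} (s≤s z≤n)) (≤-reflexive (sym (↔⇒≡ (bij φ))))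

  run-exists : 8 ≤ n → Run
  run-exists 8≤n = run-from n (step₁ v) (≤-trans order0≤7 (ℕ.≤-pred (≤-trans 8≤n (≤-reflexive (sym size)))))
    (Subset.∣p∣≤n (Subset.⊤ Subset.- v))
    where
    v : Fin n
    v = fromℕ< (≤-trans (s≤s z≤n) 8≤n)
    size : suc ∣ Subset.⊤ Subset.- v ∣ ≡ n
    size = trans (+-comm 1 _) (Invariant.room (invariant-initial v))

-- The red forest of a run

colorClass-Adj⁻ : {G : Graph n} (c : EdgeColoring G l) (i : Fin l) → ∀ {u v} → Adj (colorClass c i) u v →
                  ∃[ e ] color c u v e ≡ i
colorClass-Adj⁻ {G = G} c i {u} {v} adj-uv with T? (adj G u v)
... | yes e = e , does⁻ (color c u v e ≟ i) adj-uv

colorClass-Adj⁺ : {G : Graph n} (c : EdgeColoring G l) (i : Fin l) → ∀ {u v} (e : Adj G u v) → color c u v e ≡ i →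
                  Adj (colorClass c i) u v
colorClass-Adj⁺ {G = G} c i {u} {v} e col with T? (adj G u v)
... | yes e′ = does⁺ (color c u v e′ ≟ i) col
... | no ¬e  = contradiction e ¬e

K-Adj⁺ : {u v : Fin n} → u ≢ v → Adj (K n) u v
K-Adj⁺ {u = u} {v} u≢v with u ≟ v
... | yes eq = contradiction eq u≢v
... | no _   = tt

module Forest (Ω : TreeList) (n : ℕ) where

  open TreeList Ω
  open Extended Ω
  open Procedure Ω n
  open Execution Ω n

  module _ (R : Run) where

    private
      s  = final R
      ps = copies s
      G  = forest R

    open Packing (packing (reached R)) public
    open Layout layout public

    treeOf : ∀ p → Graph (order (index p))
    treeOf p = graph (tree (index p))

    covered : ∀ {v} → v ≢ removed s → ∃[ p ] p ∈ ps × ∃[ x ] at p x ≡ v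
    covered {v} v≢ with covers v
    ... | inj₁ eq        = contradiction eq v≢
    ... | inj₂ (inj₁ v∈) = contradiction v∈ (∣s∣≡0⇒∉ (available s) full)
    ... | inj₂ (inj₂ c)  = c

    sameCopy : ∀ {p q x y} → p ∈ ps → q ∈ ps → at p x ≡ at q y → p ≡ q
    sameCopy {x = x} {y} p∈ q∈ eq with AllPairs-lookup disjoint p∈ q∈
    ... | inj₁ p≡q        = p≡q
    ... | inj₂ (inj₁ pq)  = contradiction eq (pq x y)
    ... | inj₂ (inj₂ qp)  = contradiction (sym eq) (qp y x)

    sameIndex : ∀ {p q} → p ∈ ps → q ∈ ps → index p ≡ index q → p ≡ q
    sameIndex p∈ q∈ eq with AllPairs-lookup distinctIndices p∈ q∈
    ... | inj₁ p≡q       = p≡q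
    ... | inj₂ (inj₁ ne) = contradiction eq ne
    ... | inj₂ (inj₂ ne) = contradiction (sym eq) ne

    forest-Adj⁻ : ∀ {u v} → Adj G u v → ∃[ p ] p ∈ ps × InCopy u v p
    forest-Adj⁻ {u} {v} e with colorClass-Adj⁻ (coloring s) red {u} {v} e
    ... | _ , col with red? ps u v
    ... | yes r = find r
    ... | no _ with () ← col

    forest-Adj⁺ : ∀ {p x y} → p ∈ ps → Adj (treeOf p) x y → Adj G (at p x) (at p y)
    forest-Adj⁺ {p} {x} {y} p∈ e = colorClass-Adj⁺ (coloring s) red
      (K-Adj⁺ (Adj-irrefl (treeOf p) e ∘ injective p))
      (cong (λ b → if b then red else blue)
        (dec-true (red? ps (at p x) (at p y)) (Any.map (λ { refl → x , y , refl , refl , e }) p∈)))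

    forest-Adj-at : ∀ {p x v} → p ∈ ps → Adj G (at p x) v → ∃[ y ] at p y ≡ v × Adj (treeOf p) x y
    forest-Adj-at {p} {x} p∈ e with forest-Adj⁻ e
    ... | q , q∈ , x′ , y , qx′≡ , qy≡ , xy with refl ← sameCopy q∈ p∈ qx′≡ with refl ← injective p qx′≡ =
      y , qy≡ , xy

    forest-adj : ∀ {p} → p ∈ ps → ∀ x y → adj G (at p x) (at p y) ≡ adj (treeOf p) x y
    forest-adj {p} p∈ x y = T-ext
      (λ e → let y′ , eq , xy′ = forest-Adj-at p∈ e in subst (Adj (treeOf p) x) (injective p eq) xy′)
      (forest-Adj⁺ p∈)

    treeOf-neighbour : ∀ p x → ∃[ y ] Adj (treeOf p) x y
    treeOf-neighbour p x = neighbour (nontrivial (index p)) (treeOf p) (proj₁ (isTree (tree (index p)))) x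
      where
      neighbour : 1 < m → (H : Graph m) → Connected H → ∀ x → ∃[ y ] Adj H x y
      neighbour {suc zero} (s≤s ())
      neighbour {suc (suc m)} _ H (_ , path) x with path x (punchIn x zero) | Fin.punchInᵢ≢i x zero
      ... | p | ne = first p (ne ∘ sym)
        where
        first : ∀ {x y} → Star (Adj H) x y → x ≢ y → ∃[ z ] Adj H x z
        first ε x≢x     = contradiction refl x≢x
        first (e ◅ _) _ = _ , e

    forest-isolated : ∀ u → ¬ Adj G (removed s) u
    forest-isolated u e with forest-Adj⁻ e
    ... | p , p∈ , x , _ , eq , _ = avoids p∈ x eq

    forest-neighbour : ∀ v → v ≢ removed s → ∃[ u ] Adj G v u
    forest-neighbour v v≢ with covered v≢
    ... | p , p∈ , x , refl = let y , xy = treeOf-neighbour p x in at p y , forest-Adj⁺ p∈ xy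

    forest-almostSpanning : AlmostSpanning R
    forest-almostSpanning = forest-neighbour , forest-isolated

    -- Red edges do not leave a copy, so a cycle lies within the copy of its first edge and pulls
    -- back to the tree.
    forest-isForest : IsForest G
    forest-isForest k C with forest-Adj⁻ (Cycle.step C zero)
    ... | p , p∈ , x₀ , _ , eq₀ , _ = proj₂ (isTree (tree (index p))) k record
      { vertex    = proj₁ ∘ inside-p
      ; injective = λ {i} {j} eq → C.injective
          (trans (sym (proj₂ (inside-p i))) (trans (cong (at p) eq) (proj₂ (inside-p j))))
      ; step      = λ i → pull (C.step i)
      ; close     = pull C.close
      }
      where
      module C = Cycle C
      inside-p : ∀ i → ∃[ x ] at p x ≡ C.vertex i
      inside-p = <-weakInduction (λ i → ∃[ x ] at p x ≡ C.vertex i) (x₀ , eq₀)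
        λ { i (x , eq) → let y , eq′ , _ = forest-Adj-at p∈ (subst (λ u → Adj G u _) (sym eq) (C.step i)) in y , eq′ }

      pull : ∀ {i j} → Adj G (C.vertex i) (C.vertex j) → Adj (treeOf p) (proj₁ (inside-p i)) (proj₁ (inside-p j))
      pull {i} {j} e = subst T (trans
        (cong₂ (adj G) (sym (proj₂ (inside-p i))) (sym (proj₂ (inside-p j))))
        (forest-adj p∈ _ _)) e

    -- Copies are connected and red edges stay inside copies, so one vertex sent into q takes all of
    -- p with it.
    carry : (σ : Automorphism G) → ∀ {p q x y} → p ∈ ps → q ∈ ps → bij σ ⟨$⟩ʳ at p x ≡ at q y →
            ∀ z → ∃[ w ] bij σ ⟨$⟩ʳ at p z ≡ at q w
    carry σ {p} {q} {x} {y} p∈ q∈ eq z = along (proj₂ (proj₁ (isTree (tree (index p)))) x z) eq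
      where
      along : ∀ {x z y} → Star (Adj (treeOf p)) x z → bij σ ⟨$⟩ʳ at p x ≡ at q y → ∃[ w ] bij σ ⟨$⟩ʳ at p z ≡ at q w
      along ε eq = _ , eq
      along (e ◅ path) eq =
        let y′ , eq′ , _ = forest-Adj-at q∈ (subst (λ u → Adj G u _) eq (≅-adj σ (forest-Adj⁺ p∈ e)))
        in along path (sym eq′)

    copies-≅ : (σ : Automorphism G) → ∀ {p q x y} → p ∈ ps → q ∈ ps → bij σ ⟨$⟩ʳ at p x ≡ at q y →
               ∃[ φ ] (∀ z → bij σ ⟨$⟩ʳ at p z ≡ at q (bij {G = treeOf p} {H = treeOf q} φ ⟨$⟩ʳ z))
    copies-≅ σ {p} {q} {x} {y} p∈ q∈ eq = record
      { bij       = Perm.permutation (proj₁ ∘ there-q) (proj₁ ∘ back)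
          (λ w → injective q (trans (sym (proj₂ (there-q _))) (trans (cong (bij σ ⟨$⟩ʳ_) (sym (proj₂ (back w)))) (inverseʳ (bij σ)))))
          (λ z → injective p (trans (sym (proj₂ (back _))) (trans (cong (bij σ ⟨$⟩ˡ_) (sym (proj₂ (there-q z)))) (inverseˡ (bij σ)))))
      ; preserves = λ z z′ → trans (sym (forest-adj q∈ _ _))
          (trans (cong₂ (adj G) (sym (proj₂ (there-q z))) (sym (proj₂ (there-q z′))))
            (trans (preserves σ _ _) (forest-adj p∈ z z′)))
      } , proj₂ ∘ there-q
      where
      there-q = carry σ p∈ q∈ eq
      back = carry (≅-sym σ) q∈ p∈ (trans (cong (bij σ ⟨$⟩ˡ_) (sym eq)) (inverseˡ (bij σ)))

    -- If its image had a red neighbour, that edge would pull back along σ to a red edge at the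
    -- removed vertex; and only the removed vertex has no neighbour.
    removed-fixed : (σ : Automorphism G) → bij σ ⟨$⟩ʳ removed s ≡ removed s
    removed-fixed σ = decidable-stable (σv ≟ removed s) λ moved →
      let u , e = forest-neighbour σv moved
      in forest-isolated (bij σ ⟨$⟩ˡ u) (≅-adj⁻ σ {removed s} {bij σ ⟨$⟩ˡ u} (subst (Adj G σv) (sym (inverseʳ (bij σ))) e))
      where σv = bij σ ⟨$⟩ʳ removed s

    -- An automorphism carries each copy onto a copy of an isomorphic tree, hence onto itself.
    forest-asymmetric : Asymmetric G
    forest-asymmetric σ v with v ≟ removed s
    ... | yes refl = removed-fixed σ
    ... | no v≢ with covered v≢ | covered (λ σv≡ → v≢ (Permutation-injective (bij σ) (trans σv≡ (sym (removed-fixed σ)))))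
    ... | p , p∈ , x , refl | q , q∈ , y , eq with copies-≅ σ p∈ q∈ (sym eq)
    ... | φ , agrees with refl ← sameIndex p∈ q∈ (distinct (index p) (index q) φ) =
      trans (agrees x) (cong (at p) (asymmetric (tree (index p)) φ x))

    private
      rooted : ∀ p → ∃[ r ] ∃[ par ] ParentMap (treeOf p) (r ∷ []) par
      rooted p = tree-ParentMap (treeOf p) (isTree (tree (index p)))

      root : Copy → Fin n
      root p = at p (proj₁ (rooted p))

      -- One root for each component; the removed vertex is the root of its own.
      roots : List (Fin n)
      roots = removed s ∷ map root ps

      roots-unique : Unique roots
      roots-unique =
        All.tabulate (λ r∈ eq → case ∈-map⁻ root r∈ of λ { (p , p∈ , refl) → avoids p∈ _ (sym eq) }) ∷
        AllPairsP.map⁺ (AllPairs.map (λ d → d _ _) disjoint)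

      parentIn : ∀ v → Dec (v ≡ removed s) → Fin n
      parentIn v (yes _) = v
      parentIn v (no v≢) = let p , _ , x , _ = covered v≢ in at p (proj₁ (proj₂ (rooted p)) x)

      par : Fin n → Fin n
      par v = parentIn v (v ≟ removed s)

      parentIn-at : ∀ {p} → p ∈ ps → ∀ x d → parentIn (at p x) d ≡ at p (proj₁ (proj₂ (rooted p)) x)
      parentIn-at p∈ x (yes eq) = contradiction eq (avoids p∈ x)
      parentIn-at {p} p∈ x (no v≢) with covered v≢
      ... | q , q∈ , y , eq with refl ← sameCopy q∈ p∈ eq with refl ← injective p eq = refl

      ∉roots : ∀ {p x} → p ∈ ps → x ∉ proj₁ (rooted p) ∷ [] → at p x ∉ roots
      ∉roots p∈ x∉ (here eq) = avoids p∈ _ eq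
      ∉roots {p} p∈ x∉ (there x∈) with ∈-map⁻ root x∈
      ... | q , q∈ , eq with refl ← sameCopy p∈ q∈ eq = x∉ (here (injective p eq))

      forest-ParentMap : ParentMap G roots par
      forest-ParentMap u v e with forest-Adj⁻ {u} {v} e
      ... | p , p∈ , x , y , refl , refl , xy with proj₂ (proj₂ (rooted p)) x y xy
      ... | inj₁ (x∉ , eq) = inj₁ (∉roots p∈ x∉ , trans (cong (at p) eq) (sym (parentIn-at p∈ x (at p x ≟ removed s))))
      ... | inj₂ (y∉ , eq) = inj₂ (∉roots p∈ y∉ , trans (cong (at p) eq) (sym (parentIn-at p∈ y (at p y ≟ removed s))))

    #edges-forest≤ : #edges G + suc (length ps) ≤ n
    #edges-forest≤ = subst (λ l → #edges G + suc l ≤ n) (length-map root ps)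
      (#edges-ParentMap G roots-unique forest-ParentMap)

-- Colorings of complete graphs and the cost

module _ {n : ℕ} where

  K-automorphism : Permutation n n → Automorphism (K n)
  K-automorphism π = record
    { bij       = π
    ; preserves = λ u v → T-ext
        (λ e → K-Adj⁺ λ u≡v → Adj-irrefl (K n) e (cong (π ⟨$⟩ʳ_) u≡v))
        (λ e → K-Adj⁺ λ πu≡πv → Adj-irrefl (K n) e (Permutation-injective π πu≡πv))
    }

  -- With two colors, a color is determined by whether it equals h. A permutation that preserves one
  -- color class therefore preserves the coloring.
  Fin2-ext : ∀ h {i j : Fin 2} → (i ≡ h → j ≡ h) → (j ≡ h → i ≡ h) → j ≡ i
  Fin2-ext _  {0F} {0F} _ _ = refl
  Fin2-ext _  {1F} {1F} _ _ = refl
  Fin2-ext 0F {0F} {1F} f _ = f refl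
  Fin2-ext 0F {1F} {0F} _ g = sym (g refl)
  Fin2-ext 1F {0F} {1F} _ g = sym (g refl)
  Fin2-ext 1F {1F} {0F} f _ = f refl

  distinguishing⇒asymmetric : (c : EdgeColoring (K n) 2) → ∀ h → Distinguishing c → Asymmetric (colorClass c h)
  distinguishing⇒asymmetric c h dist σ = dist (K-automorphism (bij σ)) λ u v e e′ → Fin2-ext h
    (λ col → proj₂ (colorClass-Adj⁻ c h {bij σ ⟨$⟩ʳ u} {bij σ ⟨$⟩ʳ v} (≅-adj σ {u} {v} (colorClass-Adj⁺ c h e col))))
    (λ col → proj₂ (colorClass-Adj⁻ c h {u} {v} (≅-adj⁻ σ {u} {v} (colorClass-Adj⁺ c h e′ col))))

  asymmetric⇒distinguishing : (c : EdgeColoring (K n) 2) → Asymmetric (colorClass c 0F) → Distinguishing c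
  asymmetric⇒distinguishing c asym σ pres = asym record
    { bij       = bij σ
    ; preserves = λ u v → T-ext
        (λ f → let e′ , col = colorClass-Adj⁻ c 0F {bij σ ⟨$⟩ʳ u} {bij σ ⟨$⟩ʳ v} f ; e = ≅-adj⁻ σ {u} {v} e′
               in colorClass-Adj⁺ c 0F e (trans (sym (pres u v e e′)) col))
        (λ f → let e , col = colorClass-Adj⁻ c 0F {u} {v} f ; e′ = ≅-adj σ {u} {v} e
               in colorClass-Adj⁺ c 0F e′ (trans (pres u v e e′) col))
    }

-- With no color an edge cannot be colored; with one color the transposition of two vertices
-- preserves the coloring.
distinguishing⇒2≤ : 2 ≤ n → ∀ j (c : EdgeColoring (K n) j) → Distinguishing c → 2 ≤ j
distinguishing⇒2≤ {suc (suc n)} _ zero c _ with () ← color c zero (suc zero) tt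
distinguishing⇒2≤ {suc (suc n)} _ (suc zero) c dist =
  case dist (K-automorphism (Perm.transpose zero (suc zero))) (λ _ _ _ _ → Fin1-unique _ _) zero of λ ()
  where
  Fin1-unique : (x y : Fin 1) → x ≡ y
  Fin1-unique zero zero = refl
distinguishing⇒2≤ {suc zero} (s≤s ()) _ _ _
distinguishing⇒2≤ _ (suc (suc j)) _ _ = s≤s (s≤s z≤n)

module Cost (Ω : TreeList) (n : ℕ) (8≤n : 8 ≤ n) where

  open Extended Ω
  open Procedure Ω n
  open Execution Ω n

  R₀ : Run
  R₀ = run-exists 8≤n

  k : ℕ
  k = suc (length (copies (final R₀)))

  k-maximal : Maximal n k
  k-maximal = Packing.maximal (packing (reached R₀))

  length-copies : ∀ R → suc (length (copies (final R))) ≡ k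
  length-copies R = ℕ.≤-antisym (Maximal-greatest k-maximal (proj₁ max)) (Maximal-greatest max (proj₁ k-maximal))
    where max = Packing.maximal (packing (reached R))

  asymmetric⇒#edges≥ : (G : Graph n) → Asymmetric G → n ∸ k ≤ #edges G
  asymmetric⇒#edges≥ G asym with Components.lower-bound G Ω asym
  ... | t , fits , n≤ = ℕ.m≤n+o⇒m∸n≤o n k (≤-trans n≤ (≤-trans
    (+-monoʳ-≤ (#edges G) (Maximal-greatest k-maximal fits)) (≤-reflexive (+-comm (#edges G) k))))

  -- The parent map gives at most n - k edges; the forest is itself asymmetric, so the general lower
  -- bound gives the converse.
  #edges-forest : ∀ R → n ∸ k ≡ #edges (forest R)
  #edges-forest R = ℕ.≤-antisym
    (asymmetric⇒#edges≥ (forest R) (Forest.forest-asymmetric Ω n R))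
    (ℕ.m+n≤o⇒m≤o∸n (#edges (forest R))
      (subst (λ l → #edges (forest R) + l ≤ n) (length-copies R) (Forest.#edges-forest≤ Ω n R)))

  k≤n : k ≤ n
  k≤n = ≤-trans (ℕ.m≤n+m k _) (subst (λ l → #edges (forest R₀) + l ≤ n) (length-copies R₀) (Forest.#edges-forest≤ Ω n R₀))

  c₀ : EdgeColoring (K n) 2
  c₀ = coloring (final R₀)

  c₀-distinguishing : Distinguishing c₀
  c₀-distinguishing = asymmetric⇒distinguishing c₀ (Forest.forest-asymmetric Ω n R₀)

  isEdgeCost : IsEdgeCost (K n) (n ∸ k)
  isEdgeCost = record
    { index-two = (c₀ , c₀-distinguishing) , distinguishing⇒2≤ (≤-trans (s≤s (s≤s z≤n)) 8≤n)
    ; attained  = c₀ , c₀-distinguishing ,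
        -- Red is the smaller class: the blue graph is asymmetric too, so it obeys the same lower
        -- bound, which red attains.
        trans (ℕ.m≤n⇒m⊓n≡m (≤-trans (≤-reflexive (sym (#edges-forest R₀)))
                (asymmetric⇒#edges≥ _ (distinguishing⇒asymmetric c₀ 1F c₀-distinguishing))))
          (sym (#edges-forest R₀))
    ; minimal   = λ c dist → ℕ.⊓-glb (asymmetric⇒#edges≥ _ (distinguishing⇒asymmetric c 0F dist))
                                     (asymmetric⇒#edges≥ _ (distinguishing⇒asymmetric c 1F dist))
    }

-- The claims about all runs and all expansions come with the existence of a run and of an
-- expansion, so neither is vacuous. The formula is stated over the integers, where subtraction is
-- not truncated.
theorem3p2 : (a : ℕ → ℕ) → CountsAsymTrees a →
    (Ω : TreeList) →
    (n : ℕ) → 8 ≤ n →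
    let open Procedure Ω n in
    ∃[ ρ ] IsEdgeCost (K n) ρ
      × Run
      × (∀ (R : Run) → IsForest (forest R) × Asymmetric (forest R) × AlmostSpanning R
           × ρ ≡ #edges (forest R))
      × (∃[ N ] ∃[ w ] ∃[ r ] Expansion a n N w r)
      × (∀ N w r → Expansion a n N w r → + ρ ≡ + n - + (∑₁ N a) - + w)
theorem3p2 a counts Ω n 8≤n =
  n ∸ k , isEdgeCost , R₀ ,
  (λ R → forest-isForest R , forest-asymmetric R , forest-almostSpanning R , #edges-forest R) ,
  expansion n , λ N w r → formula k-maximal k≤n
  where
  open Cost Ω n 8≤n
  open Forest Ω n
  open Counting Ω counts
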